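{- For all integers $t \geq 4$ and $k \geq 1$, $$gr_{k}(K_{3}:P_{t}^{+})=\begin{cases}2(t-1)\cdot5^{\frac{k-2}{2}}+1 & \text{ if $k$ is even,}\\ (t-1)\cdot5^{\frac{k-1}{2}}+1 & \text{ if $k$ is odd.}\end{cases}$$
   Context: For $t \geq 3$, $P_t$ denotes the path on $t$ vertices $v_1v_2\cdots v_t$, and $P_t^{+}$ denotes the graph obtained from $P_t$ by adding the edge $v_1v_3$ (forming a triangle at one end). A coloring of the edges of a graph is rainbow if no two edges receive the same color. For a positive integer $k$ and a graph $H$, the Gallai-Ramsey number $gr_k(K_3:H)$ is the minimum integer $m$ such that every coloring of the edges of the complete graph $K_m$ using at most $k$ colors contains either a rainbow triangle or a monochromatic copy of $H$. -}

module Defs where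

open import Data.Nat using (ℕ; zero; suc; _+_; _*_; _∸_; _^_; _<_; _≤_; _/_)
open import Data.Nat.Properties using ()
open import Data.Fin using (Fin; toℕ)
open import Data.Product using (Σ; ∃; _×_; _,_)
open import Data.Sum using (_⊎_)
open import Relation.Nullary using (¬_)
open import Relation.Binary.PropositionalEquality using (_≡_; _≢_)
open import Function.Definitions using (Injective)

-- An edge coloring of the complete graph K_m (vertex set Fin m) with at most
-- k colors (color set Fin k).  Only values on pairs of distinct vertices
-- matter; we require symmetry so it is a coloring of undirected edges.
record EdgeColoring (m k : ℕ) : Set where
  field
    col  : Fin m → Fin m → Fin k
    symm : ∀ x y → col x y ≡ col y x
open EdgeColoring public

RainbowTriangle : ∀ {m k} → EdgeColoring m k → Set
RainbowTriangle {m} c =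
  Σ (Fin m) λ x → Σ (Fin m) λ y → Σ (Fin m) λ z →
    (x ≢ y) × (y ≢ z) × (x ≢ z) ×
    (col c x y ≢ col c y z) × (col c y z ≢ col c x z) × (col c x y ≢ col c x z)

-- A monochromatic copy of P_t^+ : the path v_1 ... v_t (vertices indexed
-- 0 .. t-1 here) plus the chord v_1 v_3, embedded injectively into K_m,
-- with all its edges of one color a.
MonoPtPlus : ∀ {m k} → (t : ℕ) → EdgeColoring m k → Set
MonoPtPlus {m} {k} t c =
  Σ (Fin t → Fin m) λ f → Σ (Fin k) λ a →
    Injective _≡_ _≡_ f ×
    (∀ (i j : Fin t) → suc (toℕ i) ≡ toℕ j → col c (f i) (f j) ≡ a) ×
    (∀ (i j : Fin t) → toℕ i ≡ 0 → toℕ j ≡ 2 → col c (f i) (f j) ≡ a)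

GRProperty : ℕ → ℕ → ℕ → Set
GRProperty k t n =
  (c : EdgeColoring n k) → RainbowTriangle c ⊎ MonoPtPlus t c

IsGRNumber : ℕ → ℕ → ℕ → Set
IsGRNumber k t n = GRProperty k t n × (∀ m → m < n → ¬ GRProperty k t m)

module Submission where

-- Write s = t - 1 and call P_n^+ a lollipop of size n. The bound s * h (k - 1), with
-- h 0 = 1, h 1 = 2, h (k + 2) = 5 * h k, is proved with a deficit d for every colour: colours
-- of deficit 0 have no lollipop of size > s, colours of deficit d > 0 have no path on more than
-- s - d vertices, and then |V| plus the sum of the deficits is at most s * h (k - 1).
-- Take a Gallai partition with colours red and blue. A class P that is not small can be woven
-- with the vertices joined to it in red: each of them raises the red deficit of P by one, and
-- s of them exclude red from P altogether; the same holds in blue. Induction applied to P and to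
-- its red and blue neighbourhoods gives the bound. If all classes are small, a maximal pair of
-- a red and a blue rope (path or lollipop, according to the deficit) covers almost all of V:
-- with ends w and u, a vertex left out is blue to w and red to u, so whatever the colour of wu,
-- it can be appended together with w or u to one of the ropes.
-- For the lower bound, blow up pentagons, and substitute copies of K_s for the vertices.

-- A positive deficit speaks of paths rather than lollipops because of what weaving creates: a
-- vertex joined in red to all of P closes a triangle with any red edge of P, so a red path of P
-- together with its connectors forms a lollipop of V. A lollipop bound on V thus becomes a path
-- bound on P, lowered by the number of connectors. As the neighbours of P reappear as deficits of
-- P, the bounded quantity, |V| plus the deficits, does not drop when V is replaced by P. Where a
-- colour is excluded instead, `h` pays: 2 * h k is at most h (k + 1) if one colour goes, and the
-- factor 5 = 1 + 2 + 2 covers P and its two neighbourhoods if both go. The Gallai partition is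
-- proved from scratch: a cut crossed by at most two colours yields a partition, and a partition
-- yields a cut of the set with one more vertex.

open import Defs
open import Data.Nat using (ℕ; zero; suc; _+_; _*_; _∸_; _^_; _≤_; _<_; z≤n; s≤s; s≤s⁻¹)
open import Data.Nat.Properties
open import Data.Nat.Tactic.RingSolver using (solve; solve-∀)
open import Data.List using (List; []; _∷_)
open import Data.Product using (∃; _×_; _,_)
open import Relation.Binary.PropositionalEquality using (_≡_; _≢_; refl; sym; trans; cong)

-- Linear arithmetic

infixl 6 _⊕_
_⊕_ : ∀ {a b c d} → a ≤ b → c ≤ d → a + c ≤ b + d
_⊕_ = +-mono-≤

-- j is the slack of a linear certificate, and μ leaves room for rounding.
≤-by : ∀ {a b l r} μ j → l ≤ r → suc μ * a + r + j ≡ suc μ * b + μ + l → a ≤ b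
≤-by {a} {b} {l} {r} μ j l≤r e = ≮⇒≥ λ b<a → <⇒≱ (begin-strict
  suc μ * b + μ          <⟨ +-monoʳ-< (suc μ * b) (n<1+n μ) ⟩
  suc μ * b + suc μ      ≡⟨ trans (+-comm (suc μ * b) (suc μ)) (sym (*-suc (suc μ) b)) ⟩
  suc μ * suc b          ≤⟨ *-monoʳ-≤ (suc μ) b<a ⟩
  suc μ * a              ∎) (+-cancelʳ-≤ l _ _ (begin
  suc μ * a + l          ≤⟨ +-monoʳ-≤ (suc μ * a) l≤r ⟩
  suc μ * a + r          ≤⟨ m≤m+n _ j ⟩
  suc μ * a + r + j      ≡⟨ e ⟩
  suc μ * b + μ + l      ∎))
  where open ≤-Reasoning

rope-bound₂ : ∀ N a d₁ b d₂ s q → N ≤ a + b + q → a + d₁ ≤ s → b + d₂ ≤ s → N + d₁ + d₂ ≤ s + s + q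
rope-bound₂ N a d₁ b d₂ s q h1 h2 h3 =
  ≤-by 0 0 (h1 ⊕ h2 ⊕ h3)
    (solve (N ∷ a ∷ d₁ ∷ b ∷ d₂ ∷ s ∷ q ∷ []))

seed₁ : ∀ N m o q → N ≤ m + o + q → m + m + (q + q + 1) ≤ N → suc m + q ≤ o
seed₁ N m o q h1 h2 = ≤-by 0 0 (h1 ⊕ h2) (solve (N ∷ m ∷ o ∷ q ∷ []))

seed₂ : ∀ N m o q → N ≤ m + o + q → m + q + 3 ≤ N → 3 ≤ o
seed₂ N m o q h1 h2 = ≤-by 0 0 (h1 ⊕ h2) (solve (N ∷ m ∷ o ∷ q ∷ []))

seed₃ : ∀ N m o q → N ≤ m + o + q → m + (q + q + q) + 3 ≤ N → q + q + 3 ≤ o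
seed₃ N m o q h1 h2 = ≤-by 0 0 (h1 ⊕ h2) (solve (N ∷ m ∷ o ∷ q ∷ []))

pair-absurd : ∀ N d₁ d₂ s q → s + s + (q + q + 1) ≤ N + d₁ + d₂ → N + d₁ + d₂ ≤ s + s + q → 1 ≤ 0
pair-absurd N d₁ d₂ s q h1 h2 = ≤-by 0 q (h1 ⊕ h2) (solve (N ∷ d₁ ∷ d₂ ∷ s ∷ q ∷ []))

path-size₁ :
  ∀ N m d s q → m + suc d ≤ s → s + s + (q + q + 1) ≤ N + suc d + 0 → m + m + (q + q + 1) ≤ N
path-size₁ N m d s q h1 h2 = ≤-by 0 (d + 1) (h1 ⊕ h1 ⊕ h2) (solve (N ∷ m ∷ d ∷ s ∷ q ∷ []))

path-size₂ :
  ∀ N m d s q → m + suc d ≤ s → s + s + (q + q + 1) ≤ N + suc d + 0 → 3 ≤ s → m + q + 3 ≤ N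
path-size₂ N m d s q h1 h2 h3 = ≤-by 0 (q + 1) (h1 ⊕ h2 ⊕ h3) (solve (N ∷ m ∷ d ∷ s ∷ q ∷ []))

lolly-size₁ : ∀ N m s q → m + 0 ≤ s → s + s + (q + q + 1) ≤ N + 0 + 0 → m + m + (q + q + 1) ≤ N
lolly-size₁ N m s q h1 h2 = ≤-by 0 0 (h1 ⊕ h1 ⊕ h2) (solve (N ∷ m ∷ s ∷ q ∷ []))

lolly-size₂ : ∀ N m s q → m + 0 ≤ s → s + s + (q + q + 1) ≤ N + 0 + 0 → 3 ≤ s → m + q + 3 ≤ N
lolly-size₂ N m s q h1 h2 h3 = ≤-by 0 (q + 1) (h1 ⊕ h2 ⊕ h3) (solve (N ∷ m ∷ s ∷ q ∷ []))

lolly-size₃ :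
  ∀ N m s q → m + 0 ≤ s → s + s + (q + q + 1) ≤ N + 0 + 0 → 5 * q + 6 ≤ N →
  m + (q + q + q) + 3 ≤ N
lolly-size₃ N m s q h1 h2 h3 = ≤-by 1 (q + 2) (h1 ⊕ h1 ⊕ h2 ⊕ h3) (solve (N ∷ m ∷ s ∷ q ∷ []))

neighbours-absurd :
  ∀ N c r b q → N ≤ c + (r + b) → c ≤ suc q → r < q + q + 3 → b < q + q + 3 → 5 * q + 6 ≤ N →
  1 ≤ 0
neighbours-absurd N c r b q h1 h2 h3 h4 h5 =
  ≤-by 0 0 (h1 ⊕ h2 ⊕ h3 ⊕ h4 ⊕ h5)
    (solve (N ∷ c ∷ r ∷ b ∷ q ∷ []))

bound-long : ∀ n d ρ s l → 2 + (ρ + ρ) ≤ n → n + d ≤ s → l ≤ ρ → l + (ρ + d) ≤ s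
bound-long n d ρ s l h1 h2 h3 = ≤-by 0 2 (h1 ⊕ h2 ⊕ h3) (solve (n ∷ d ∷ ρ ∷ s ∷ l ∷ []))

bound-absurd : ∀ n d p s → p + p + 1 ≤ n + 2 → n + d ≤ s → s + 3 ≤ p + p → 1 ≤ 0
bound-absurd n d p s h1 h2 h3 = ≤-by 0 (d + 1) (h1 ⊕ h2 ⊕ h3) (solve (n ∷ d ∷ p ∷ s ∷ []))

bound-single : ∀ n d ρ s → 1 + (suc ρ + suc ρ) ≤ n → n + d ≤ s → 1 + (suc ρ + d) ≤ s
bound-single n d ρ s h1 h2 = ≤-by 0 (ρ + 1) (h1 ⊕ h2) (solve (n ∷ d ∷ ρ ∷ s ∷ []))

bound-single-absurd : ∀ n d p s → p + p + 1 ≤ n + 1 → n + d ≤ s → s + 3 ≤ p + p → 1 ≤ 0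
bound-single-absurd n d p s h1 h2 h3 = ≤-by 0 (d + 2) (h1 ⊕ h2 ⊕ h3) (solve (n ∷ d ∷ p ∷ s ∷ []))

edge-absurd₁ : ∀ n ρ s → 2 + (ρ + ρ) ≤ n → n + 0 ≤ s → s ≤ ρ + ρ + 1 → 1 ≤ 0
edge-absurd₁ n ρ s h1 h2 h3 = ≤-by 0 0 (h1 ⊕ h2 ⊕ h3) (solve (n ∷ ρ ∷ s ∷ []))

edge-absurd₂ : ∀ n p s → p + p + 1 ≤ n + 2 → n + 0 ≤ s → s + 2 ≤ p + p → 1 ≤ 0
edge-absurd₂ n p s h1 h2 h3 = ≤-by 0 0 (h1 ⊕ h2 ⊕ h3) (solve (n ∷ p ∷ s ∷ []))

zigzag-count : ∀ y p P → P ≤ y + p → P + P + 1 ≤ (y + p + suc p) + y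
zigzag-count y p P h1 = ≤-by 0 0 (h1 ⊕ h1) (solve (y ∷ p ∷ P ∷ []))

-- The numbers `h k` and the rounding of `s / 2`

-- The largest order of a complete graph coloured with `k` colours without rainbow and without
-- monochromatic triangles.
h : ℕ → ℕ
h 0 = 1
h 1 = 2
h (suc (suc k)) = 5 * h k

n<h : ∀ k → k < h k
n<h 0 = s≤s z≤n
n<h 1 = s≤s (s≤s z≤n)
n<h (suc (suc k)) = ≤-trans (s≤s (s≤s (n<h k))) (≤-by 0 (h k + h k) (+-mono-≤ (1≤h k) (1≤h k)) (lemma (h k)))
  where
  1≤h : ∀ k → 1 ≤ h k
  1≤h k = ≤-trans (s≤s z≤n) (n<h k)
  lemma : ∀ x → 1 * suc (suc x) + (x + x) + (x + x) ≡ 1 * (5 * x) + 0 + 2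
  lemma = solve-∀

double-h : ∀ k → h k + h k ≤ h (suc k)
double-h 0 = ≤-refl
double-h 1 = s≤s (s≤s (s≤s (s≤s z≤n)))
double-h (suc (suc k)) = ≤-trans (≤-reflexive (sym (*-distribˡ-+ 5 (h k) (h k)))) (*-monoʳ-≤ 5 (double-h k))

-- Deficits below `s` of the `suc m` colours outside the partition leave `4 * s` of the bound; by
-- `n<h` this comes down to `m + 5 ≤ 5 * suc m`.
room : ∀ s m → suc m * s + (s + s + s + s) ≤ s * (5 * h m)
room s m = ≤-trans (≤-reflexive (regroup s m)) (*-monoʳ-≤ s
  (≤-trans (m+n≤o⇒m≤o (m + 5) (≤-reflexive (expand m))) (*-monoʳ-≤ 5 (n<h m))))
  where
  regroup : ∀ s m → suc m * s + (s + s + s + s) ≡ s * (m + 5)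
  regroup = solve-∀
  expand : ∀ m → m + 5 + 4 * m ≡ 5 * suc m
  expand = solve-∀

five-comm : ∀ s g → 5 * (s * g) ≡ s * (5 * g)
five-comm = solve-∀

half : ∀ s → ∃ λ q → q + q ≤ s × s ≤ q + q + 1
half zero = 0 , z≤n , z≤n
half (suc zero) = 0 , z≤n , ≤-refl
half (suc (suc s)) with half s
... | q , q≤ , ≤q = suc q , s≤s (≤-trans (≤-reflexive (+-suc q q)) (s≤s q≤))
                  , s≤s (≤-trans (s≤s ≤q) (≤-reflexive (cong (_+ 1) (sym (+-suc q q)))))

-- Inequalities for the induction on the vertex set

dominated :
  ∀ N d₁ d₂ T p r b Y → N ≤ p + (r + b) → p + ((r + d₁) + ((b + d₂) + T)) ≤ Y →
  N + (d₁ + (d₂ + T)) ≤ Y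
dominated N d₁ d₂ T p r b Y h1 h2 =
  ≤-by 0 0 (h1 ⊕ h2)
    (solve (N ∷ d₁ ∷ d₂ ∷ T ∷ p ∷ r ∷ b ∷ Y ∷ []))

doubled :
  ∀ N d₂ T p r b X Y → N ≤ p + (r + b) → p + ((b + d₂) + T) ≤ X → r + (d₂ + T) ≤ X →
  X + X ≤ Y → N + (0 + (d₂ + T)) ≤ Y
doubled N d₂ T p r b X Y h1 h2 h3 h4 =
  ≤-by 0 (d₂ + T) (h1 ⊕ h2 ⊕ h3 ⊕ h4)
    (solve (N ∷ d₂ ∷ T ∷ p ∷ r ∷ b ∷ X ∷ Y ∷ []))

quintupled :
  ∀ N T p r b G → N ≤ p + (r + b) → p + T ≤ G → r ≤ G + G → b ≤ G + G →
  N + (0 + (0 + T)) ≤ 5 * G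
quintupled N T p r b G h1 h2 h3 h4 =
  ≤-by 0 0 (h1 ⊕ h2 ⊕ h3 ⊕ h4)
    (solve (N ∷ T ∷ p ∷ r ∷ b ∷ G ∷ []))

side-sum : ∀ r x y T T₁ G → r ≤ x + y → x + T ≤ G → y + T₁ ≤ G → r ≤ G + G
side-sum r x y T T₁ G h1 h2 h3 =
  ≤-by 0 (T + T₁) (h1 ⊕ h2 ⊕ h3)
    (solve (r ∷ x ∷ y ∷ T ∷ T₁ ∷ G ∷ []))

twice-large : ∀ s r → 3 ≤ s → s ≤ r → s + 2 ≤ r + r
twice-large s r h1 h2 = ≤-by 0 1 (h1 ⊕ h2 ⊕ h2) (solve (s ∷ r ∷ []))

large-odd : ∀ s p → s + 3 ≤ p + p → s ≤ p + p + 1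
large-odd s p h1 = ≤-by 0 4 h1 (solve (s ∷ p ∷ []))

half-class : ∀ s q x → x + x < s + 3 → s ≤ q + q + 1 → x ≤ suc q
half-class s q x h1 h2 = ≤-by 1 0 (h1 ⊕ h2) (solve (s ∷ q ∷ x ∷ []))

greedy-room₁ : ∀ s q r → s + s < r → q + q ≤ s → 3 ≤ s → suc s + q ≤ r
greedy-room₁ s q r h1 h2 _ = ≤-by 0 q (h1 ⊕ h2) (solve (s ∷ q ∷ r ∷ []))

greedy-room₂ : ∀ s q r → s + s < r → q + q ≤ s → 3 ≤ s → q + q + 3 ≤ r
greedy-room₂ s q r h1 h2 h3 = ≤-by 0 1 (h1 ⊕ h2 ⊕ h3) (solve (s ∷ q ∷ r ∷ []))

small-room₁ :
  ∀ N E d₁ d₂ T m s q Y → Y < N + (d₁ + (d₂ + T)) → T + suc m ≤ E → E + (s + s + s + s) ≤ Y →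
  q + q ≤ s → s + s + (q + q + 1) ≤ N + d₁ + d₂
small-room₁ N E d₁ d₂ T m s q Y h1 h2 h3 h4 =
  ≤-by 0 (m + s + 1) (h1 ⊕ h2 ⊕ h3 ⊕ h4)
    (solve (N ∷ E ∷ d₁ ∷ d₂ ∷ T ∷ m ∷ s ∷ q ∷ Y ∷ []))

small-room₂ :
  ∀ N E T m s q Y → Y < N + (0 + (0 + T)) → T + suc m ≤ E → E + (s + s + s + s) ≤ Y →
  q + q ≤ s → 3 ≤ s → 5 * q + 6 ≤ N
small-room₂ N E T m s q Y h1 h2 h3 h4 h5 =
  ≤-by 1 (2 * m + 2) (h1 ⊕ h1 ⊕ h2 ⊕ h2 ⊕ h3 ⊕ h3 ⊕ h4 ⊕ h4 ⊕ h4 ⊕ h4 ⊕ h4 ⊕ h5 ⊕ h5 ⊕ h5)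
    (solve (N ∷ E ∷ T ∷ m ∷ s ∷ q ∷ Y ∷ []))

pair-room₁ : ∀ N d₁ d₂ s → s * 2 < N + (d₁ + (d₂ + 0)) → s + s + (0 + 0 + 1) ≤ N + d₁ + d₂
pair-room₁ N d₁ d₂ s h1 = ≤-by 0 0 h1 (solve (N ∷ d₁ ∷ d₂ ∷ s ∷ []))

pair-room₂ : ∀ N s → s * 2 < N + (0 + (0 + 0)) → 3 ≤ s → 6 ≤ N
pair-room₂ N s h1 h2 = ≤-by 0 1 (h1 ⊕ h2 ⊕ h2) (solve (N ∷ s ∷ []))

singleton-room : ∀ N D k Y → N ≤ 1 → D + suc k ≤ Y → N + D ≤ Y
singleton-room N D k Y h1 h2 = ≤-by 0 k (h1 ⊕ h2) (solve (N ∷ D ∷ k ∷ Y ∷ []))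

sum-step : ∀ d D s k Y → d < s → D + k ≤ Y → d + D + suc k ≤ s + Y
sum-step d D s k Y h1 h2 = ≤-by 0 0 (h1 ⊕ h2) (solve (d ∷ D ∷ s ∷ k ∷ Y ∷ []))

-- Opened only here: solve needs an unambiguous _∷_.
open import Data.Fin using (Fin; zero; suc; toℕ; opposite; inject₁; inject≤; fromℕ<; remQuot; combine)
import Data.Fin.Properties as Fin
open import Data.Fin.Properties
  using (opposite-prop; opposite-involutive; toℕ<n; toℕ-inject₁; inject≤-injective; combine-remQuot;
         pigeonhole)
open import Data.List using (_++_; length; filter; take; drop; map; lookup; allFin; tabulate)
open import Data.List.Properties
  using (length-++; filter-notAll; take++drop≡id; length-take; length-drop; ++-assoc;
         map-∘; map-id; length-map; length-tabulate)
open import Data.List.Membership.Propositional using (_∈_; _∉_; find; lose)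
open import Data.List.Membership.Propositional.Properties
  using (∈-∃++; ∈-++⁺ˡ; ∈-++⁺ʳ; ∈-++⁻; ∈-filter⁺; ∈-filter⁻; ∈-length; ∈-map⁻; ∈-lookup; ∈-allFin)
open import Data.List.Membership.DecPropositional using () renaming (_∈?_ to member?)
open import Data.List.Relation.Unary.Any using (Any; here; there; any?)
open import Data.List.Relation.Unary.All using ([]; _∷_)
import Data.List.Relation.Unary.All as All
import Data.List.Relation.Unary.All.Properties as AllP
open import Data.List.Relation.Unary.AllPairs using ([]; _∷_)
import Data.List.Relation.Unary.AllPairs as AllPairs
open import Data.List.Relation.Unary.Unique.Propositional using (Unique)
import Data.List.Relation.Unary.Unique.Propositional.Properties as Uniq
open import Data.List.Relation.Unary.Unique.DecPropositional using (unique?)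
open import Data.List.Relation.Binary.Subset.Propositional using (_⊆_)
import Data.List.Relation.Binary.Subset.Propositional.Properties as Sub
open import Data.List.Relation.Binary.Permutation.Propositional
  using (_↭_; prep; ↭-sym; ↭-trans; ↭-refl; ↭-reflexive; ↭⇒↭ₛ) renaming (swap to swap↭)
open import Data.List.Relation.Binary.Permutation.Propositional.Properties
  using (shift; ∈-resp-↭; ↭-length; ++⁺ˡ; ++⁺ʳ; ++-comm)
import Data.List.Relation.Binary.Permutation.Propositional.Properties as PermP
import Data.List.Relation.Binary.Permutation.Setoid.Properties as PermS
open import Data.Nat.ListAction using (sum)
open import Data.Nat.ListAction.Properties using (sum-↭)
open import Data.Product using (∃₂; proj₁; proj₂; uncurry) renaming (swap to swap×)
open import Data.Sum using (_⊎_; inj₁; inj₂; [_,_]′; swap)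
import Data.Vec as Vec
open import Data.Empty using (⊥)
open import Function using (_∘_; id)
open import Function.Definitions using (Injective)
open import Relation.Binary using (DecidableEquality)
open import Relation.Binary.PropositionalEquality using (cong₂; subst; subst₂; setoid)
open import Relation.Nullary using (¬_; Dec; yes; no; contradiction; ¬?)
open import Relation.Nullary.Decidable using (_×-dec_; _⊎-dec_; _→-dec_; decidable-stable; from-yes)
open import Relation.Unary using (Decidable)

-- Lists without repetition

module _ {A : Set} where

  Unique-resp-↭ : {xs ys : List A} → xs ↭ ys → Unique xs → Unique ys
  Unique-resp-↭ p = PermS.Unique-resp-↭ (setoid A) (↭⇒↭ₛ p)

  length-mono-⊆ : {xs ys : List A} → Unique xs → xs ⊆ ys → length xs ≤ length ys
  length-mono-⊆ {[]} _ _ = z≤n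
  length-mono-⊆ {x ∷ xs} {ys} (x∉ ∷ u) sub with ∈-∃++ (sub (here refl))
  ... | as , bs , refl = begin
      suc (length xs)              ≤⟨ s≤s (length-mono-⊆ u sub′) ⟩
      suc (length (as ++ bs))      ≡⟨ ↭-length (↭-sym (shift x as bs)) ⟩
      length (as ++ x ∷ bs)        ∎
    where
    open ≤-Reasoning
    sub′ : xs ⊆ as ++ bs
    sub′ {y} y∈xs with ∈-resp-↭ (shift x as bs) (sub (there y∈xs))
    ... | here refl = contradiction refl (All.lookup x∉ y∈xs)
    ... | there y∈ = y∈

  -- If the elements failing `Q` fit into a list shorter than `V`, some element is left over. All
  -- fresh vertices are found in this way.
  search : ∀ {V : List A} {Q : A → Set} → Decidable Q → Unique V → ∀ Ls →
           length Ls < length V → (∀ {z} → z ∈ V → ¬ Q z → z ∈ Ls) →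
           ∃ λ z → z ∈ V × Q z
  search {V} Q? u Ls lt cov with any? Q? V
  ... | yes p = find p
  ... | no ¬p = contradiction (length-mono-⊆ u λ z∈V → cov z∈V (¬p ∘ lose z∈V)) (<⇒≱ lt)

  inhabited : ∀ {V : List A} → 0 < length V → ∃ (_∈ V)
  inhabited {x ∷ _} _ = x , here refl

  ∉⇒Unique : ∀ {x : A} {xs} → x ∉ xs → Unique xs → Unique (x ∷ xs)
  ∉⇒Unique x∉ u = AllP.¬Any⇒All¬ _ x∉ ∷ u

  cons-⊆ : ∀ {x : A} {xs ys} → x ∈ ys → xs ⊆ ys → x ∷ xs ⊆ ys
  cons-⊆ x∈ _ (here refl) = x∈
  cons-⊆ _ s (there p) = s p

  Unique-++ˡ : ∀ (xs : List A) {ys} → Unique (xs ++ ys) → Unique xs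
  Unique-++ˡ [] _ = []
  Unique-++ˡ (x ∷ xs) (x∉ ∷ u) = AllP.++⁻ˡ xs x∉ ∷ Unique-++ˡ xs u

  Unique-++ʳ : ∀ (xs : List A) {ys} → Unique (xs ++ ys) → Unique ys
  Unique-++ʳ [] u = u
  Unique-++ʳ (_ ∷ xs) (_ ∷ u) = Unique-++ʳ xs u

  take-⊆ : ∀ n (xs : List A) → take n xs ⊆ xs
  take-⊆ n xs x∈ = subst (_ ∈_) (take++drop≡id n xs) (∈-++⁺ˡ x∈)

  take-++ : ∀ (xs ys : List A) n → take (length xs + n) (xs ++ ys) ≡ xs ++ take n ys
  take-++ [] ys n = refl
  take-++ (x ∷ xs) ys n = cong (x ∷_) (take-++ xs ys n)

  split-off : ∀ {xs P : List A} → Unique xs → xs ⊆ P → ∃ λ ps → P ↭ xs ++ ps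
  split-off {[]} {P} _ _ = P , ↭-refl
  split-off {x ∷ xs} {P} (x∉ ∷ u) s with ∈-∃++ (s (here refl))
  ... | as , bs , refl with split-off u sub′
    where
    sub′ : xs ⊆ as ++ bs
    sub′ y∈ with ∈-resp-↭ (shift x as bs) (s (there y∈))
    ... | here refl = contradiction refl (All.lookup x∉ y∈)
    ... | there y∈′ = y∈′
  ...   | ps , perm = ps , ↭-trans (shift x as bs) (prep x perm)

-- Monochromatic paths and lollipops

data Kind : Set where
  path lolly : Kind

kind : ℕ → Kind
kind zero    = lolly
kind (suc _) = path

kind-lolly : ∀ d → kind d ≡ lolly → d ≡ 0
kind-lolly zero _ = refl

module Coloring {A C : Set} (_≟_ : DecidableEquality A) (_≟ᶜ_ : DecidableEquality C)
  (col : A → A → C) (col-sym : ∀ x y → col x y ≡ col y x) where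

  _∈?_ = member? _≟_

  -- The head of the list is the free end, where ropes grow; the triangle of a lollipop sits at the
  -- end of the list, in reverse of the numbering of P_t^+.
  data Rope : Kind → C → List A → Set where
    nil : ∀ {e} → Rope path e []
    one : ∀ {e} x → Rope path e (x ∷ [])
    tri : ∀ {e x y z} → col x y ≡ e → col y z ≡ e → col x z ≡ e → Rope lolly e (x ∷ y ∷ z ∷ [])
    ext : ∀ {κ e w x xs} → col w x ≡ e → Rope κ e (x ∷ xs) → Rope κ e (w ∷ x ∷ xs)

  record RopeIn (κ : Kind) (e : C) (V : List A) (n : ℕ) : Set where
    constructor rope
    field
      {list} : List A
      len    : length list ≡ n
      uniq   : Unique list
      sub    : list ⊆ V
      isRope : Rope κ e list

  lolly⇒path : ∀ {e xs} → Rope lolly e xs → Rope path e xs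
  lolly⇒path (tri p q _) = ext p (ext q (one _))
  lolly⇒path (ext p r) = ext p (lolly⇒path r)

  lolly-length : ∀ {e xs} → Rope lolly e xs → 3 ≤ length xs
  lolly-length (tri _ _ _) = ≤-refl
  lolly-length (ext _ r) = ≤-trans (lolly-length r) (n≤1+n _)

  -- A bare triangle is the only rope that cannot give up its end.
  shrink : ∀ {κ e x xs} → Rope κ e (x ∷ xs) → Rope κ e xs ⊎ (κ ≡ lolly × length xs ≡ 2)
  shrink (one _) = inj₁ nil
  shrink (tri _ _ _) = inj₂ (refl , refl)
  shrink (ext _ r) = inj₁ r

  widen : ∀ {κ e V W n} → V ⊆ W → RopeIn κ e V n → RopeIn κ e W n
  widen V⊆W (rope l u s r) = rope l u (V⊆W ∘ s) r

  rope-length≤ : ∀ {κ e V n} → RopeIn κ e V n → n ≤ length V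
  rope-length≤ (rope refl u s _) = length-mono-⊆ u s

  -- Vertex sets split into small classes

  module Parts (V : List A) (V! : Unique V) (π : A → A) (q : ℕ)
    (class≤ : ∀ x → length (filter (λ y → π y ≟ π x) V) ≤ suc q) where

    class : A → List A
    class x = filter (λ y → π y ≟ π x) V

    rest-class : A → List A
    rest-class w = filter (λ y → ¬? (y ≟ w)) (class w)

    rest-class≤ : ∀ {w} → w ∈ V → length (rest-class w) ≤ q
    rest-class≤ {w} w∈V = s≤s⁻¹ (≤-trans (filter-notAll _ _ (lose w∈ λ f → f refl)) (class≤ w))
      where w∈ = ∈-filter⁺ (λ y → π y ≟ π w) w∈V refl

    ∈-rest-class : ∀ {w z} → z ∈ V → π z ≡ π w → z ≢ w → z ∈ rest-class w
    ∈-rest-class z∈ e ne = ∈-filter⁺ _ (∈-filter⁺ _ z∈ e) ne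

    restrict≤ : ∀ {O} → Unique O → O ⊆ V → ∀ x → length (filter (λ y → π y ≟ π x) O) ≤ suc q
    restrict≤ {O} O! O⊆V x = ≤-trans (length-mono-⊆ (Uniq.filter⁺ (λ y → π y ≟ π x) O!) sub) (class≤ x)
      where
      sub : filter (λ y → π y ≟ π x) O ⊆ class x
      sub y∈ with ∈-filter⁻ (λ y → π y ≟ π x) y∈
      ... | y∈O , e = ∈-filter⁺ (λ y → π y ≟ π x) (O⊆V y∈O) e

    -- As `w` itself lies in `L`, its class blocks at most `q` further vertices.
    pick : ∀ {w L} → w ∈ L → w ∈ V → length L + suc q ≤ length V →
           ∃ λ z → z ∈ V × z ∉ L × π z ≢ π w
    pick {w} {L} w∈L w∈V le =
      search (λ z → ¬? (z ∈? L) ×-dec ¬? (π z ≟ π w)) V! (L ++ rest-class w) lt cov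
      where
      lt : length (L ++ rest-class w) < length V
      lt rewrite length-++ L {rest-class w} = ≤-trans (s≤s (+-monoʳ-≤ (length L) (rest-class≤ w∈V)))
             (≤-trans (≤-reflexive (sym (+-suc (length L) q))) le)
      cov : ∀ {z} → z ∈ V → ¬ (z ∉ L × π z ≢ π w) → z ∈ L ++ rest-class w
      cov {z} z∈V ¬Q with z ∈? L | π z ≟ π w
      ... | yes z∈L | _ = ∈-++⁺ˡ z∈L
      ... | no z∉L | no ne = contradiction (z∉L , ne) ¬Q
      ... | no z∉L | yes e = ∈-++⁺ʳ L (∈-rest-class z∈V e λ { refl → z∉L w∈L })

    module Monochromatic (e : C) (cross : ∀ {x y} → x ∈ V → y ∈ V → π x ≢ π y → col x y ≡ e) where

      extend : ∀ {κ n} → RopeIn κ e V (suc n) → suc n + suc q ≤ length V → RopeIn κ e V (suc (suc n))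
      extend (rope {w ∷ l} len u s r) le
        with pick {w} {w ∷ l} (here refl) (s (here refl)) (≤-trans (≤-reflexive (cong (_+ suc q) len)) le)
      ... | z , z∈ , z∉ , ne =
        rope (cong suc len) (∉⇒Unique z∉ u) (cons-⊆ z∈ s) (ext (cross z∈ (s (here refl)) ne) r)

      extends : ∀ {κ n} j → RopeIn κ e V (suc n) → suc n + j + q ≤ length V → RopeIn κ e V (suc n + j)
      extends {n = n} zero r le = subst (RopeIn _ e V) (sym (+-identityʳ (suc n))) r
      extends {n = n} (suc j) r le = subst (RopeIn _ e V) (sym (+-suc (suc n) j))
        (extend (extends j r (≤-trans (+-monoˡ-≤ q (+-monoʳ-≤ (suc n) (n≤1+n j))) le))
          (≤-trans (≤-reflexive (lemma n j q)) le))
        where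
        lemma : ∀ n j q → suc (n + j) + suc q ≡ suc n + suc j + q
        lemma = solve-∀

      -- The classes of two vertices cover at most `2 * q + 2` vertices, so a third class exists.
      triangle : q + q + 3 ≤ length V → RopeIn lolly e V 3
      triangle le with inhabited (≤-trans (s≤s z≤n) (≤-trans (m≤n+m 3 (q + q)) le))
      ... | x , x∈
        with pick {x} {x ∷ []} (here refl) x∈ (≤-trans (≤-trans (m≤m+n (2 + q) (q + 1)) (≤-reflexive (lemma q))) le)
        where
        lemma : ∀ q → 2 + q + (q + 1) ≡ q + q + 3
        lemma = solve-∀
      ... | y , y∈ , _ , y≢x
        with search (λ z → ¬? (π z ≟ π x) ×-dec ¬? (π z ≟ π y)) V! (class x ++ class y) lt cov
        where
        lt : length (class x ++ class y) < length V
        lt rewrite length-++ (class x) {class y} =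
          ≤-trans (s≤s (+-mono-≤ (class≤ x) (class≤ y))) (≤-trans (≤-reflexive (lemma q)) le)
          where
          lemma : ∀ q → suc (suc q + suc q) ≡ q + q + 3
          lemma = solve-∀
        cov : ∀ {z} → z ∈ V → ¬ (π z ≢ π x × π z ≢ π y) → z ∈ class x ++ class y
        cov {z} z∈ ¬Q with π z ≟ π x | π z ≟ π y
        ... | yes p | _ = ∈-++⁺ˡ (∈-filter⁺ _ z∈ p)
        ... | no _ | yes p = ∈-++⁺ʳ (class x) (∈-filter⁺ _ z∈ p)
        ... | no p | no p′ = contradiction (p , p′) ¬Q
      ... | z , z∈ , z≢x , z≢y = rope refl
            (∉⇒Unique (λ { (here refl) → y≢x refl ; (there (here refl)) → z≢x refl ; (there (there ())) })
              (∉⇒Unique (λ { (here refl) → z≢y refl ; (there ()) }) (∉⇒Unique (λ ()) [])))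
            (cons-⊆ x∈ (cons-⊆ y∈ (cons-⊆ z∈ λ ())))
            (tri (cross x∈ y∈ (y≢x ∘ sym)) (cross y∈ z∈ (z≢y ∘ sym)) (cross x∈ z∈ (z≢x ∘ sym)))

      -- The greedy rope stops only inside the class of its end.
      greedy : ∀ {κ} T → 1 ≤ T → T + q ≤ length V →
               (κ ≡ lolly → 3 ≤ T × q + q + 3 ≤ length V) → RopeIn κ e V T
      greedy {lolly} _ _ le big with big refl
      ... | s≤s (s≤s (s≤s {n = j} z≤n)) , room = extends j (triangle room) le
      greedy {path} _ (s≤s {n = j} _) le _ with inhabited (≤-trans (s≤s z≤n) le)
      ... | x , x∈ = extends j (rope refl (∉⇒Unique (λ ()) []) (cons-⊆ x∈ λ ()) (one x)) le

  -- Two colours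

  Lim : ℕ → C → ℕ → List A → Set
  Lim s e d V = ∀ {n} → RopeIn (kind d) e V n → n + d ≤ s

  module TwoColours (V : List A) (V! : Unique V) (π : A → A) (q : ℕ)
    (class≤ : ∀ x → length (filter (λ y → π y ≟ π x) V) ≤ suc q)
    (homogeneous : ∀ {x y z} → x ∈ V → y ∈ V → z ∈ V → π x ≡ π y → π z ≢ π x → col z x ≡ col z y)
    where

    open Parts V V! π q class≤

    N = length V

    module Directed (red blue : C)
      (cross : ∀ {x y} → x ∈ V → y ∈ V → π x ≢ π y → col x y ≡ red ⊎ col x y ≡ blue) where

      record Pair (κ₁ κ₂ : Kind) (n : ℕ) : Set where
        constructor pair
        field
          L₁ L₂   : List A
          sum≡    : length L₁ + length L₂ ≡ n
          uniq    : Unique (L₁ ++ L₂)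
          sub     : L₁ ++ L₂ ⊆ V
          redRope : Rope κ₁ red L₁
          bluRope : Rope κ₂ blue L₂

      -- The lower bound σ on the size of the pair ensures that a rope which has to give up its
      -- end is not a bare triangle: otherwise the other rope could be prolonged beyond short₁, short₂.
      module Grow (κ₁ κ₂ : Kind) (σ : ℕ)
        (short₁ : ∀ {m} → κ₂ ≡ lolly → RopeIn κ₁ red V m → m + 3 ≤ σ)
        (short₂ : ∀ {m} → κ₁ ≡ lolly → RopeIn κ₂ blue V m → m + 3 ≤ σ) where

        add : ∀ {n z L₁′ L₂′} (p : Pair κ₁ κ₂ n) → let open Pair p in z ∈ V → z ∉ L₁ ++ L₂ →
              L₁′ ++ L₂′ ↭ z ∷ (L₁ ++ L₂) → Rope κ₁ red L₁′ → Rope κ₂ blue L₂′ → Pair κ₁ κ₂ (suc n)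
        add {L₁′ = L₁′} {L₂′} (pair L₁ L₂ refl u s _ _) z∈ z∉ perm r₁ r₂ = pair L₁′ L₂′
          (trans (sym (length-++ L₁′)) (trans (↭-length perm) (cong suc (length-++ L₁))))
          (Unique-resp-↭ (↭-sym perm) (∉⇒Unique z∉ u))
          (λ x∈ → cons-⊆ z∈ s (∈-resp-↭ perm x∈)) r₁ r₂

        outside : ∀ {n} (p : Pair κ₁ κ₂ n) → let open Pair p in n + suc q ≤ N → ∃ λ z → z ∈ V × z ∉ L₁ ++ L₂
        outside (pair L₁ L₂ refl u s _ _) le = search (λ z → ¬? (z ∈? (L₁ ++ L₂))) V! (L₁ ++ L₂)
          (≤-trans (≤-reflexive (cong suc (length-++ L₁)))
            (≤-trans (s≤s (m≤m+n _ q)) (≤-trans (≤-reflexive (sym (+-suc _ q))) le)))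
          λ { {z} _ ¬¬∈ → decidable-stable (z ∈? (L₁ ++ L₂)) ¬¬∈ }

        grow : ∀ {n} → σ ≤ n → Pair κ₁ κ₂ n → n + suc q ≤ N → Pair κ₁ κ₂ (suc n)
        grow _ p@(pair [] L₂ _ _ _ nil r₂) le with outside p le
        ... | z , z∈ , z∉ = add p z∈ z∉ ↭-refl (one z) r₂
        grow _ p@(pair L₁@(_ ∷ _) [] _ _ _ r₁ nil) le with outside p le
        ... | z , z∈ , z∉ = add p z∈ z∉ (shift z L₁ []) r₁ (one z)
        grow {n} σ≤n p@(pair L₁@(w ∷ l₁) L₂@(u ∷ l₂) refl uq s r₁ r₂) le with π w ≟ π u
        -- Ends in one class: by homogeneity `z` sees `w` and `u` in the same colour and prolongs
        -- the rope of that colour.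
        ... | yes πw≡πu with pick {w} {L₁ ++ L₂} (here refl) (s (here refl))
                            (≤-trans (≤-reflexive (cong (_+ suc q) (length-++ L₁))) le)
        ...   | z , z∈ , z∉ , ne with cross z∈ (s (here refl)) ne
        ...     | inj₁ zw = add p z∈ z∉ ↭-refl (ext zw r₁) r₂
        ...     | inj₂ zw = add p z∈ z∉ (shift z L₁ L₂) r₁
                    (ext (trans (sym (homogeneous (s (here refl)) (s (∈-++⁺ʳ L₁ (here refl))) z∈ πw≡πu ne)) zw) r₂)
        grow {n} σ≤n p@(pair L₁@(w ∷ l₁) L₂@(u ∷ l₂) refl uq s r₁ r₂) le | no πw≢πu
          with cross (s (here refl)) (s (∈-++⁺ʳ L₁ (here refl))) πw≢πu
        -- For red `wu` it is enough that `z` avoids the class of `u`. If `zu` is red too, `u` moves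
        -- to the red rope and `z` follows it, a net gain of one vertex.
        ... | inj₁ wu with pick {u} {L₁ ++ L₂} (∈-++⁺ʳ L₁ (here refl)) (s (∈-++⁺ʳ L₁ (here refl)))
                            (≤-trans (≤-reflexive (cong (_+ suc q) (length-++ L₁))) le)
        ...   | z , z∈ , z∉ , ne with cross z∈ (s (∈-++⁺ʳ L₁ (here refl))) ne | shrink r₂
        ...     | inj₂ zu | _ = add p z∈ z∉ (shift z L₁ L₂) r₁ (ext zu r₂)
        ...     | inj₁ zu | inj₁ r₂′ = add p z∈ z∉ (prep z (↭-sym (shift u L₁ l₂)))
                    (ext zu (ext (trans (col-sym u w) wu) r₁)) r₂′
        -- The blue rope is a bare triangle, so `n` is `length L₁ + 3`, whereas `short₁` for
        -- `u ∷ L₁` requires `length L₁ + 4 ≤ σ`.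
        ...     | inj₁ _ | inj₂ (κ₂≡ , len) = contradiction
                    (≤-trans (≤-trans (≤-reflexive (lemma (length l₁))) (short₁ κ₂≡ longer))
                      (≤-trans σ≤n (≤-reflexive (cong (λ k → length L₁ + suc k) len))))
                    (<-irrefl refl)
          where
          lemma : ∀ a → suc (suc a + 3) ≡ suc (suc a) + 3
          lemma = solve-∀
          perm = shift u L₁ l₂
          longer : RopeIn κ₁ red V (suc (length L₁))
          longer = rope refl (Unique-++ˡ (u ∷ L₁) (Unique-resp-↭ perm uq))
            (λ x∈ → s (∈-resp-↭ (↭-sym perm) (∈-++⁺ˡ x∈))) (ext (trans (col-sym u w) wu) r₁)
        grow {n} σ≤n p@(pair L₁@(w ∷ l₁) L₂@(u ∷ l₂) refl uq s r₁ r₂) le | no πw≢πu | inj₂ wu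
          with pick {w} {L₁ ++ L₂} (here refl) (s (here refl))
                            (≤-trans (≤-reflexive (cong (_+ suc q) (length-++ L₁))) le)
        ...   | z , z∈ , z∉ , ne with cross z∈ (s (here refl)) ne | shrink r₁
        ...     | inj₁ zw | _ = add p z∈ z∉ ↭-refl (ext zw r₁) r₂
        ...     | inj₂ zw | inj₁ r₁′ = add p z∈ z∉ (↭-trans (shift z l₁ (w ∷ L₂)) (prep z (shift w l₁ L₂)))
                    r₁′ (ext zw (ext wu r₂))
        ...     | inj₂ _ | inj₂ (κ₁≡ , len) = contradiction
                    (≤-trans (≤-trans (≤-reflexive (lemma (length l₂))) (short₂ κ₁≡ longer))
                      (≤-trans σ≤n (≤-reflexive (cong (λ k → suc k + length L₂) len))))
                    (<-irrefl refl)
          where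
          lemma : ∀ a → suc (3 + suc a) ≡ suc (suc a) + 3
          lemma = solve-∀
          perm = shift w l₁ L₂
          longer : RopeIn κ₂ blue V (suc (length L₂))
          longer = rope refl (Unique-++ʳ l₁ (Unique-resp-↭ (↭-sym perm) uq))
            (λ x∈ → s (∈-resp-↭ perm (∈-++⁺ʳ l₁ x∈))) (ext wu r₂)

        saturate : ∀ fuel {n} → N < n + fuel → σ ≤ n → Pair κ₁ κ₂ n → ∃ λ n′ → Pair κ₁ κ₂ n′ × N ≤ n′ + q
        saturate fuel {n} lt σ≤n p with n + suc q ≤? N
        ... | no ¬le = n , p , s≤s⁻¹ (≤-trans (≰⇒> ¬le) (≤-reflexive (+-suc n q)))
        saturate zero lt _ p | yes le = contradiction (≤-trans (m≤m+n _ _) le) (<⇒≱ (≤-trans lt (≤-reflexive (+-identityʳ _))))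
        saturate (suc fuel) {n} lt σ≤n p | yes le =
          saturate fuel (≤-trans lt (≤-reflexive (+-suc n fuel))) (≤-trans σ≤n (n≤1+n n)) (grow σ≤n p le)

      -- A saturated pair misses at most `q` vertices, and its ropes have at most `s - d₁` and
      -- `s - d₂`.
      pair-bound : ∀ {s d₁ d₂ σ} → Lim s red d₁ V → Lim s blue d₂ V →
        (∀ {m} → d₂ ≡ 0 → RopeIn (kind d₁) red V m → m + 3 ≤ σ) →
        (∀ {m} → d₁ ≡ 0 → RopeIn (kind d₂) blue V m → m + 3 ≤ σ) →
        Pair (kind d₁) (kind d₂) σ → N + d₁ + d₂ ≤ s + s + q
      pair-bound {s} {d₁} {d₂} {σ} lim₁ lim₂ short₁ short₂ p
        with Grow.saturate (kind d₁) (kind d₂) σ (short₁ ∘ kind-lolly d₂) (short₂ ∘ kind-lolly d₁)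
               (suc N) (m≤n+m (suc N) σ) ≤-refl p
      ... | _ , pair L₁ L₂ refl u sub r₁ r₂ , le = rope-bound₂ N (length L₁) d₁ (length L₂) d₂ s q le
        (lim₁ (rope refl (Unique-++ˡ L₁ u) (sub ∘ ∈-++⁺ˡ) r₁))
        (lim₂ (rope refl (Unique-++ʳ L₁ u) (sub ∘ ∈-++⁺ʳ L₁) r₂))

      -- The vertex `w` is shared: it ends the red rope and lies in the blue triangle. Handing it
      -- over to blue leaves `l` and four blue vertices, `m + 3` in all. This is the `σ` that `Grow`
      -- asks for when `m` is the size of a longest red rope; `o″` makes up for the loss of `w`.
      record Seed (κ : Kind) (m : ℕ) : Set where
        constructor seed
        field
          {w o o′ o″} : A
          {l}         : List A
          len         : suc (length l) ≡ m
          uniq        : Unique (l ++ o″ ∷ w ∷ o ∷ o′ ∷ [])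
          sub         : l ++ o″ ∷ w ∷ o ∷ o′ ∷ [] ⊆ V
          redRope     : Rope κ red (w ∷ l)
          bluRope     : Rope lolly blue (o″ ∷ w ∷ o ∷ o′ ∷ [])

      -- Since the red rope cannot be prolonged, the vertices `O` off the rope and outside the class
      -- of `w` are all blue to `w`. A blue edge in `O` closes a blue triangle with `w`. Without
      -- one, `O` is red across its classes and large enough for a red rope with one vertex more.
      plant : ∀ {κ m} → RopeIn κ red V (suc m) → ¬ RopeIn κ red V (2 + m) →
              let m = suc m in m + m + (q + q + 1) ≤ N → m + q + 3 ≤ N →
              (κ ≡ lolly → m + (q + q + q) + 3 ≤ N) → Seed κ m
      plant {κ} {m} (rope {M@(w ∷ l)} len u s r) maximal b₁ b₂ b₃ = found
        where
        O? = λ y → ¬? (y ∈? M) ×-dec ¬? (π y ≟ π w)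
        O = filter O? V
        O! = Uniq.filter⁺ O? V!
        w∈V = s (here refl)

        O⊆V : O ⊆ V
        O⊆V = proj₁ ∘ ∈-filter⁻ O?

        O∩M : ∀ {y} → y ∈ O → y ∉ M
        O∩M y∈O = proj₁ (proj₂ (∈-filter⁻ O? {xs = V} y∈O))

        count : N ≤ suc m + length O + q
        count = ≤-trans (length-mono-⊆ V! cov) (≤-trans (≤-reflexive
            (trans (length-++ (M ++ O)) (cong (_+ length (rest-class w)) (trans (length-++ M) (cong (_+ length O) len)))))
            (+-monoʳ-≤ _ (rest-class≤ w∈V)))
          where
          cov : V ⊆ (M ++ O) ++ rest-class w
          cov {y} y∈ with y ∈? M | π y ≟ π w
          ... | yes y∈M | _ = ∈-++⁺ˡ (∈-++⁺ˡ y∈M)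
          ... | no y∉ | no ne = ∈-++⁺ˡ (∈-++⁺ʳ M (∈-filter⁺ O? y∈ (y∉ , ne)))
          ... | no y∉ | yes e = ∈-++⁺ʳ (M ++ O) (∈-rest-class y∈ e λ { refl → y∉ (here refl) })

        blue-end : ∀ {y} → y ∈ O → col y w ≡ blue
        blue-end y∈O with ∈-filter⁻ O? y∈O
        ... | y∈V , y∉M , ne with cross y∈V w∈V ne
        ...   | inj₂ b = b
        ...   | inj₁ yw = contradiction (rope (cong suc len) (∉⇒Unique y∉M u) (cons-⊆ y∈V s) (ext yw r)) maximal

        blueEdge? = any? (λ o → any? (λ o′ → ¬? (o′ ≟ o) ×-dec (col o o′ ≟ᶜ blue)) O) O

        found : Seed κ (suc m)
        found with blueEdge?
        ... | no none = contradiction (widen O⊆V (greedy (2 + m) (s≤s z≤n) (seed₁ N (suc m) _ q count b₁)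
                λ { refl → ≤-trans (subst (3 ≤_) len (lolly-length r)) (n≤1+n _) , seed₃ N (suc m) _ q count (b₃ refl) }))
                maximal
          where
          crossO : ∀ {x y} → x ∈ O → y ∈ O → π x ≢ π y → col x y ≡ red
          crossO x∈ y∈ ne with cross (O⊆V x∈) (O⊆V y∈) ne
          ... | inj₁ p = p
          ... | inj₂ p = contradiction (lose x∈ (lose y∈ ((λ { refl → ne refl }) , p))) none
          module PO = Parts O O! π q (restrict≤ O! O⊆V)
          open PO.Monochromatic red crossO
        ... | yes some with find some
        ...   | o , o∈ , some′ with find some′
        ...     | o′ , o′∈ , o′≢o , oo′ with search (λ z → ¬? (z ∈? (o ∷ o′ ∷ []))) O! (o ∷ o′ ∷ [])
                    (seed₂ N (suc m) _ q count b₂) (λ {z} _ → decidable-stable (z ∈? (o ∷ o′ ∷ [])))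
        ...       | o″ , o″∈ , o″∉ = seed len
                    (Unique-resp-↭ perm (∉⇒Unique (λ { (here p) → o″∉ (here p)
                                                     ; (there (here p)) → o″∉ (there (here p))
                                                     ; (there (there p)) → O∩M o″∈ p })
                                        (∉⇒Unique (λ { (here p) → o′≢o (sym p) ; (there p) → O∩M o∈ p })
                                        (∉⇒Unique (O∩M o′∈) u))))
                    (cons-⊆ (O⊆V o″∈) (cons-⊆ (O⊆V o∈) (cons-⊆ (O⊆V o′∈) s)) ∘ ∈-resp-↭ (↭-sym perm))
                    r (ext (blue-end o″∈) (tri (trans (col-sym w o) (blue-end o∈)) oo′ (trans (col-sym w o′) (blue-end o′∈))))
          where
          perm : o″ ∷ o ∷ o′ ∷ w ∷ l ↭ l ++ o″ ∷ w ∷ o ∷ o′ ∷ []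
          perm = ↭-trans (prep o″ (shift w (o ∷ o′ ∷ []) l)) (++-comm (o″ ∷ w ∷ o ∷ o′ ∷ []) l)

      seed⇒pair : ∀ {κ m} → (κ ≡ lolly → 4 ≤ m) → Seed κ m → Pair κ lolly (m + 3)
      seed⇒pair big (seed {l = l} refl u s r₁ r₂) with shrink r₁
      ... | inj₁ r₁′ = pair l _ (+-suc (length l) 3) u s r₁′ r₂
      ... | inj₂ (κ≡ , len) = contradiction (big κ≡) (<⇒≱ (s≤s (s≤s (≤-reflexive len))))

      seed⇒rope : ∀ {κ m} → Seed κ m → RopeIn lolly blue V 4
      seed⇒rope (seed {l = l} _ u s _ r) = rope refl (Unique-++ʳ l u) (s ∘ ∈-++⁺ʳ l) r

      -- Downward induction on the length: once all longer red paths are excluded, the given one is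
      -- a longest path, and the pair grown from its seed is too large. In the end even a single
      -- vertex is excluded.
      path-lolly : ∀ {s d} → 3 ≤ s → Lim s red (suc d) V → Lim s blue 0 V →
        s + s + (q + q + 1) ≤ N + suc d + 0 → ∀ fuel {m} → N < suc m + fuel → RopeIn path red V (suc m) → ⊥
      path-lolly {s} {d} 3≤s lim₁ lim₂ big = loop
        where
        loop : ∀ fuel {m} → N < suc m + fuel → RopeIn path red V (suc m) → ⊥
        loop zero lt r = <⇒≱ (≤-trans lt (≤-reflexive (+-identityʳ _))) (rope-length≤ r)
        loop (suc fuel) {m} lt r = contradiction (pair-absurd N (suc d) 0 s q big
            (pair-bound lim₁ lim₂ (λ _ r′ → +-monoˡ-≤ 3 (≮⇒≥ λ m< → longer m< r′)) (λ ())
              (seed⇒pair (λ ()) (plant r (longer ≤-refl)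
                (path-size₁ N (suc m) d s q (lim₁ r) big) (path-size₂ N (suc m) d s q (lim₁ r) big 3≤s) (λ ())))))
            λ ()
          where
          longer : ∀ {m′} → suc m < m′ → ¬ RopeIn path red V m′
          longer (s≤s {n = m′} m<) = loop fuel
            (≤-trans lt (≤-trans (≤-reflexive (cong suc (+-suc m fuel))) (s≤s (+-monoˡ-≤ fuel m<))))

      -- Either colour may have to give up its end, so `suc m` must bound the lollipops of both
      -- colours for `σ = suc m + 3` to satisfy `short₁` and `short₂`.
      lolly-step : ∀ {s m} → 3 ≤ s → Lim s red 0 V → Lim s blue 0 V →
        s + s + (q + q + 1) ≤ N + 0 + 0 → 5 * q + 6 ≤ N → 4 ≤ suc m →
        RopeIn lolly red V (suc m) → (∀ {m′} → suc m < m′ → ¬ RopeIn lolly red V m′) →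
        (∀ {m′} → suc m < m′ → ¬ RopeIn lolly blue V m′) → ⊥
      lolly-step {s} {m} 3≤s lim₁ lim₂ big big′ 4≤m r longer₁ longer₂ = contradiction (pair-absurd N 0 0 s q big
          (pair-bound lim₁ lim₂ (λ _ r′ → +-monoˡ-≤ 3 (≮⇒≥ λ m< → longer₁ m< r′))
            (λ _ r′ → +-monoˡ-≤ 3 (≮⇒≥ λ m< → longer₂ m< r′))
            (seed⇒pair (λ _ → 4≤m) (plant r (longer₁ ≤-refl) (lolly-size₁ N (suc m) s q (lim₁ r) big)
               (lolly-size₂ N (suc m) s q (lim₁ r) big 3≤s) (λ _ → lolly-size₃ N (suc m) s q (lim₁ r) big big′)))))
          λ ()

      -- A red triangle could not be prolonged, and its seed would contain a blue lollipop of size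
      -- 4.
      lolly-start : ∀ {s} → 3 ≤ s → Lim s red 0 V → s + s + (q + q + 1) ≤ N + 0 + 0 → 5 * q + 6 ≤ N →
        ¬ RopeIn lolly red V 4 → ¬ RopeIn lolly blue V 4 → ¬ RopeIn lolly red V 3
      lolly-start {s} 3≤s lim₁ big big′ none₁ none₂ r = none₂ (seed⇒rope
        (plant r none₁ (lolly-size₁ N 3 s q (lim₁ r) big)
           (lolly-size₂ N 3 s q (lim₁ r) big 3≤s) (λ _ → lolly-size₃ N 3 s q (lim₁ r) big big′)))

      Neighbour? = λ x y → ¬? (π y ≟ π x) ×-dec (col x y ≟ᶜ red)

      -- Without red triangles, red neighbours of `x` in different classes are joined in blue, and
      -- `2 * q + 3` of them would contain a blue triangle.
      neighbours< : ∀ {x} → x ∈ V → ¬ RopeIn lolly red V 3 → ¬ RopeIn lolly blue V 3 →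
        length (filter (Neighbour? x) V) < q + q + 3
      neighbours< {x} x∈ none₁ none₂ = ≰⇒> λ le → none₂ (widen O⊆V (triangle le))
        where
        O = filter (Neighbour? x) V
        O! = Uniq.filter⁺ (Neighbour? x) V!

        O⊆V : O ⊆ V
        O⊆V = proj₁ ∘ ∈-filter⁻ (Neighbour? x)

        crossO : ∀ {y z} → y ∈ O → z ∈ O → π y ≢ π z → col y z ≡ blue
        crossO {y} {z} y∈ z∈ ne with ∈-filter⁻ (Neighbour? x) y∈ | ∈-filter⁻ (Neighbour? x) z∈
        ... | y∈V , y≢x , xy | z∈V , z≢x , xz with cross y∈V z∈V ne
        ...   | inj₂ p = p
        ...   | inj₁ p = contradiction (rope refl
                (∉⇒Unique (λ { (here refl) → y≢x refl ; (there (here refl)) → z≢x refl ; (there (there ())) })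
                  (∉⇒Unique (λ { (here refl) → ne refl ; (there ()) }) (∉⇒Unique (λ ()) [])))
                (cons-⊆ x∈ (cons-⊆ y∈V (cons-⊆ z∈V λ ()))) (tri xy p xz)) none₁

        module PO = Parts O O! π q (restrict≤ O! O⊆V)
        open PO.Monochromatic blue crossO

    two-colours : ∀ {red blue s d₁ d₂} →
      (∀ {x y} → x ∈ V → y ∈ V → π x ≢ π y → col x y ≡ red ⊎ col x y ≡ blue) →
      3 ≤ s → Lim s red d₁ V → Lim s blue d₂ V → ∃ (_∈ V) →
      s + s + (q + q + 1) ≤ N + d₁ + d₂ → (d₁ ≡ 0 → d₂ ≡ 0 → 5 * q + 6 ≤ N) → ⊥
    two-colours {red} {blue} {s} {d₁} {d₂} cross 3≤s lim₁ lim₂ (x , x∈) big big′ = go d₁ d₂ lim₁ lim₂ big big′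
      where
      module RB = Directed red blue cross
      module BR = Directed blue red (λ x∈ y∈ ne → swap (cross x∈ y∈ ne))

      single : ∀ {e} → RopeIn path e V 1
      single = rope refl (∉⇒Unique (λ ()) []) (cons-⊆ x∈ λ ()) (one x)

      go : ∀ d₁ d₂ → Lim s red d₁ V → Lim s blue d₂ V →
           s + s + (q + q + 1) ≤ N + d₁ + d₂ → (d₁ ≡ 0 → d₂ ≡ 0 → 5 * q + 6 ≤ N) → ⊥
      go (suc d₁) (suc d₂) lim₁ lim₂ big _ = contradiction (pair-absurd N (suc d₁) (suc d₂) s q big
        (RB.pair-bound {σ = 0} lim₁ lim₂ (λ ()) (λ ()) (RB.pair [] [] refl [] (λ ()) nil nil))) λ ()
      go (suc d₁) zero lim₁ lim₂ big _ = RB.path-lolly 3≤s lim₁ lim₂ big (suc N) (s≤s (m≤n+m N 1)) single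
      go zero (suc d₂) lim₁ lim₂ big _ = BR.path-lolly 3≤s lim₂ lim₁
        (subst (s + s + (q + q + 1) ≤_) (trans (cong (_+ suc d₂) (+-identityʳ N)) (sym (+-identityʳ (N + suc d₂)))) big)
        (suc N) (s≤s (m≤n+m N 1)) single
      -- No monochromatic triangle is left. As in the proof of R(3,3) ≤ 6, the class of `x` and its
      -- two neighbourhoods have at most `(q + 1) + 2 * (2 * q + 2) = 5 * q + 5` vertices.
      go zero zero lim₁ lim₂ big big′ = contradiction
          (neighbours-absurd N (length (class x)) (length (filter R? V)) (length (filter B? V)) q
          count (class≤ x) (RB.neighbours< x∈ none₁ none₂) (BR.neighbours< x∈ none₂ none₁) 5q) λ ()
        where
        5q = big′ refl refl

        loop : ∀ fuel {m} → N < suc m + fuel → 4 ≤ suc m →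
          ¬ RopeIn lolly red V (suc m) × ¬ RopeIn lolly blue V (suc m)
        loop zero lt _ = short , short
          where
          short : ∀ {κ e} → ¬ RopeIn κ e V _
          short r = <⇒≱ (≤-trans lt (≤-reflexive (+-identityʳ _))) (rope-length≤ r)
        loop (suc fuel) {m} lt 4≤m =
            (λ r → RB.lolly-step 3≤s lim₁ lim₂ big 5q 4≤m r (proj₁ ∘ longer) (proj₂ ∘ longer))
          , (λ r → BR.lolly-step 3≤s lim₂ lim₁ big 5q 4≤m r (proj₂ ∘ longer) (proj₁ ∘ longer))
          where
          longer : ∀ {m′} → suc m < m′ → ¬ RopeIn lolly red V m′ × ¬ RopeIn lolly blue V m′
          longer (s≤s {n = m′} m<) = loop fuel
            (≤-trans lt (≤-trans (≤-reflexive (cong suc (+-suc m fuel))) (s≤s (+-monoˡ-≤ fuel m<))))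
            (≤-trans 4≤m (≤-trans (n≤1+n _) (s≤s m<)))

        none₄ = loop (suc N) {3} (s≤s (m≤n+m N 4)) ≤-refl
        none₁ = RB.lolly-start 3≤s lim₁ big 5q (proj₁ none₄) (proj₂ none₄)
        none₂ = BR.lolly-start 3≤s lim₂ big 5q (proj₂ none₄) (proj₁ none₄)

        R? = RB.Neighbour? x
        B? = BR.Neighbour? x

        count : N ≤ length (class x) + (length (filter R? V) + length (filter B? V))
        count = ≤-trans (length-mono-⊆ V! cov) (≤-reflexive
            (trans (length-++ (class x)) (cong (length (class x) +_) (length-++ (filter R? V)))))
          where
          cov : V ⊆ class x ++ filter R? V ++ filter B? V
          cov {y} y∈ with π y ≟ π x
          ... | yes e = ∈-++⁺ˡ (∈-filter⁺ _ y∈ e)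
          ... | no ne with cross x∈ y∈ (ne ∘ sym)
          ...   | inj₁ p = ∈-++⁺ʳ (class x) (∈-++⁺ˡ (∈-filter⁺ R? y∈ (ne , p)))
          ...   | inj₂ p = ∈-++⁺ʳ (class x) (∈-++⁺ʳ (filter R? V) (∈-filter⁺ B? y∈ (ne , p)))

  -- Joins

  NoEdge : C → List A → Set
  NoEdge e W = ∀ {x y} → x ∈ W → y ∈ W → x ≢ y → col x y ≢ e

  Complete : C → List A → List A → Set
  Complete e P R = ∀ {p r} → p ∈ P → r ∈ R → col p r ≡ e

  rope-tail : ∀ {e x xs} → Rope path e (x ∷ xs) → Rope path e xs
  rope-tail r with shrink r
  ... | inj₁ r′ = r′

  -- Both ropes start at `x`; the path is followed away from `x` and so comes to lie reversed in
  -- front of the other rope.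
  append-rope : ∀ {κ e x ys rem} → Rope κ e (x ∷ ys) → Rope path e (x ∷ rem) →
                ∃ λ zs → Rope κ e zs × zs ↭ rem ++ x ∷ ys
  append-rope r (one _) = _ , r , ↭-refl
  append-rope {x = x} {ys} r (ext {x = y} {xs} p r′) with append-rope (ext (trans (col-sym y x) p) r) r′
  ... | zs , rz , perm = zs , rz , ↭-trans perm (shift y xs (x ∷ ys))

  -- Alternate rem and cs in front of a rope whose end is a connector; once the
  -- connectors are used up, what is left of rem must be a path itself.
  weave : ∀ {κ e c ys} cs rem → Complete e rem (c ∷ cs) → Rope κ e (c ∷ ys) →
          length cs ≤ length rem → Rope path e (drop (length cs) rem) →
          ∃ λ zs → Rope κ e zs × zs ↭ rem ++ cs ++ c ∷ ys
  weave [] [] _ r _ _ = _ , r , ↭-refl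
  weave {c = c} {ys} [] (x ∷ rem) com r _ rr with append-rope (ext (com (here refl) (here refl)) r) rr
  ... | zs , rz , perm = zs , rz , ↭-trans perm (shift x rem (c ∷ ys))
  weave {c = c} {ys} (c′ ∷ cs) (x ∷ rem) com r (s≤s le) rr
    with weave cs rem (λ p∈ r∈ → com (there p∈) (there r∈))
           (ext (trans (col-sym c′ x) (com (here refl) (there (here refl)))) (ext (com (here refl) (here refl)) r)) le rr
  ... | zs , rz , perm = zs , rz , ↭-trans perm (↭-trans
        (++⁺ˡ rem (↭-trans (shift c′ cs (x ∷ c ∷ ys)) (↭-trans (prep c′ (shift x cs (c ∷ ys))) (swap↭ c′ x ↭-refl))))
        (shift x rem (c′ ∷ cs ++ c ∷ ys)))

  weave-in : ∀ {κ e c ys cs rem P R} → Complete e P R → (∀ {v} → v ∈ P → v ∉ R) →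
             Unique (ys ++ rem) → ys ++ rem ⊆ P → Unique (c ∷ cs) → c ∷ cs ⊆ R →
             Rope κ e (c ∷ ys) → length cs ≤ length rem → Rope path e (drop (length cs) rem) →
             RopeIn κ e (P ++ R) (length ys + length rem + suc (length cs))
  weave-in {c = c} {ys} {cs} {rem} {P} {R} com dis u s u′ s′ r le rr
    with weave cs rem (λ p∈ r∈ → com (s (∈-++⁺ʳ ys p∈)) (s′ r∈)) r le rr
  ... | zs , rz , perm = rope
        (trans (↭-length perm′) (trans (length-++ (ys ++ rem)) (cong (_+ suc (length cs)) (length-++ ys))))
        (Unique-resp-↭ (↭-sym perm′) (Uniq.++⁺ u u′ λ { (p , q) → dis (s p) (s′ q) }))
        (λ z∈ → Sub.++⁺ s s′ (∈-resp-↭ perm′ z∈)) rz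
    where
    perm′ : zs ↭ (ys ++ rem) ++ c ∷ cs
    perm′ = ↭-trans perm (↭-trans (++⁺ˡ rem (++-comm cs (c ∷ ys))) (↭-trans (shift c rem (ys ++ cs))
      (↭-trans (prep c (↭-trans (↭-reflexive (sym (++-assoc rem ys cs))) (++⁺ʳ cs (++-comm rem ys))))
        (↭-sym (shift c (ys ++ rem) cs)))))

  short-path : ∀ {e} (xs : List A) → length xs ≤ 1 → Rope path e xs
  short-path [] _ = nil
  short-path (x ∷ []) _ = one x
  short-path (_ ∷ _ ∷ _) (s≤s ())

  -- The side that runs out first decides the size: either every connector is used, or every vertex
  -- of `P`.
  zigzag : ∀ {κ e c ys cs ps P} → let R = c ∷ cs in Complete e P R → (∀ {v} → v ∈ P → v ∉ R) →
           Unique P → Unique R → P ↭ ys ++ ps → Rope κ e (c ∷ ys) →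
           ∃ λ n → RopeIn κ e (P ++ R) n ×
             (length ys + (length R + length R) ≤ n ⊎ length P + length P + 1 ≤ n + length ys)
  zigzag {c = c} {ys} {cs} {ps} {P} com dis u u′ perm r with suc (length cs) ≤? length ps
  -- One vertex more than the connectors in `cs`, so that the rope ends in `P` and the remainder is
  -- a single vertex.
  ... | yes le = _ , weave-in {cs = cs} {take (suc (length cs)) ps} com dis
            (subst Unique (take-++ ys ps (suc (length cs))) (Uniq.take⁺ (length ys + suc (length cs)) (Unique-resp-↭ perm u)))
            (λ v∈ → ∈-resp-↭ (↭-sym perm) (Sub.++⁺ʳ ys (take-⊆ (suc (length cs)) ps) v∈))
            u′ id r (≤-trans (n≤1+n _) (≤-reflexive (sym len)))
            (short-path _ (≤-reflexive (trans (length-drop (length cs) _)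
              (trans (cong (_∸ length cs) len) (m+n∸n≡m 1 (length cs))))))
        , inj₁ (subst (λ k → length ys + (suc (length cs) + suc (length cs)) ≤ length ys + k + suc (length cs)) (sym len)
                  (≤-reflexive (sym (+-assoc (length ys) _ _))))
    where
    len : length (take (suc (length cs)) ps) ≡ suc (length cs)
    len = trans (length-take (suc (length cs)) ps) (m≤n⇒m⊓n≡m le)
  ... | no ¬le = _ , weave-in {cs = take (length ps) cs} {ps} com dis (Unique-resp-↭ perm u) (∈-resp-↭ (↭-sym perm))
            (Uniq.take⁺ (suc (length ps)) u′) (take-⊆ (suc (length ps)) (c ∷ cs)) r (≤-reflexive len)
            (short-path _ (≤-trans (≤-reflexive (trans (length-drop (length (take (length ps) cs)) ps)
              (trans (cong (length ps ∸_) len) (n∸n≡0 (length ps))))) z≤n))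
        , inj₂ (subst (λ k → length P + length P + 1 ≤ length ys + length ps + suc k + length ys) (sym len)
                  (zigzag-count (length ys) (length ps) (length P) (≤-reflexive (trans (↭-length perm) (length-++ ys)))))
    where
    len : length (take (length ps) cs) ≡ length ps
    len = trans (length-take (length ps) cs) (m≤n⇒m⊓n≡m (s≤s⁻¹ (≰⇒> ¬le)))

  module Joined {s e d} {V P R : List A} (lim : Lim s e d V) (P! : Unique P) (R! : Unique R)
    (P⊆V : P ⊆ V) (R⊆V : R ⊆ V) (complete : Complete e P R) (disjoint : ∀ {v} → v ∈ P → v ∉ R) where

    in-V : ∀ {κ n} → RopeIn κ e (P ++ R) n → RopeIn κ e V n
    in-V = widen λ v∈ → [ P⊆V , R⊆V ]′ (∈-++⁻ P v∈)

    -- A lollipop contains a path on the same vertices, so it is bounded whatever the kind of the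
    -- deficit.
    lolly-lim : ∀ {n} → RopeIn lolly e (P ++ R) n → n + d ≤ s
    lolly-lim r = lim (relax d (in-V r))
      where
      relax : ∀ d {n} → RopeIn lolly e V n → RopeIn (kind d) e V n
      relax zero r = r
      relax (suc _) (rope l u s r) = rope l u s (lolly⇒path r)

    -- An edge of `P` and a connector form the triangle from which the zigzag starts.
    edge-zigzag : ∀ {x y} → x ∈ P → y ∈ P → x ≢ y → col x y ≡ e → 0 < length R →
      ∃ λ n → RopeIn lolly e (P ++ R) n ×
        (2 + (length R + length R) ≤ n ⊎ length P + length P + 1 ≤ n + 2)
    edge-zigzag {x} {y} x∈ y∈ ne xy ρ>0 = go R refl ρ>0
      where
      xs! = ∉⇒Unique {xs = y ∷ []} (λ { (here p) → ne p ; (there ()) }) (∉⇒Unique (λ ()) [])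
      xs⊆ = cons-⊆ {xs = y ∷ []} x∈ (cons-⊆ {xs = []} y∈ (λ ()))
      go : ∀ R′ → R′ ≡ R → 0 < length R′ → ∃ λ n → RopeIn lolly e (P ++ R′) n ×
        (2 + (length R′ + length R′) ≤ n ⊎ length P + length P + 1 ≤ n + 2)
      go (c ∷ cs) refl _ = zigzag complete disjoint P! R! (proj₂ (split-off xs! xs⊆))
        (tri (trans (col-sym c x) (complete x∈ (here refl))) xy (trans (col-sym c y) (complete y∈ (here refl))))

    -- With fewer connectors than path vertices, the first edge and one connector form a triangle
    -- and the other connectors are inserted between the later vertices, each adding one to the
    -- size. With at least as many connectors, the zigzag from the first edge alone has
    -- `2 + 2 * length R` vertices, unless it uses up `P` and exceeds `s`.
    path-lim : ∀ {l} → s + 3 ≤ length P + length P → 0 < length R → RopeIn path e P (2 + l) → 2 + l + (length R + d) ≤ s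
    path-lim {l} big ρ>0 (rope {x ∷ y ∷ xs} len u sub r@(ext xy _)) with length R <? 2 + l
    ... | no ¬lt with edge-zigzag (sub (here refl)) (sub (there (here refl))) (All.head (AllPairs.head u)) xy ρ>0
    ...   | n , rn , inj₁ le = bound-long n d (length R) s (2 + l) le (lolly-lim rn) (≮⇒≥ ¬lt)
    ...   | n , rn , inj₂ le = contradiction (bound-absurd n d (length P) s le (lolly-lim rn) big) λ ()
    path-lim {l} big ρ>0 (rope {x ∷ y ∷ xs} len u sub r@(ext xy _)) | yes lt = go R refl ρ>0 lt
      where
      go : ∀ R′ → R′ ≡ R → 0 < length R′ → length R′ < 2 + l → 2 + l + (length R′ + d) ≤ s
      go (c ∷ cs) refl _ (s≤s (s≤s ρ≤)) = ≤-trans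
        (≤-reflexive (sym (trans (cong (λ k → 2 + k + suc (length cs) + d) l≡) (+-assoc (2 + l) (suc (length cs)) d))))
        (lolly-lim (weave-in {ys = x ∷ y ∷ []} {cs} {xs} complete disjoint u sub R! id
            (tri (trans (col-sym c x) (complete (sub (here refl)) (here refl))) xy
                 (trans (col-sym c y) (complete (sub (there (here refl))) (here refl))))
            (≤-trans ρ≤ (≤-reflexive (sym l≡))) (rope-drop (length cs) (rope-tail (rope-tail r)))))
        where
        l≡ = suc-injective (suc-injective len)
        rope-drop : ∀ {e} k {zs} → Rope path e zs → Rope path e (drop k zs)
        rope-drop zero r = r
        rope-drop (suc k) {[]} r = r
        rope-drop (suc k) {_ ∷ _} r = rope-drop k (rope-tail r)

    path⇒kind : ∀ d {n} → 0 < d → RopeIn path e V n → RopeIn (kind d) e V n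
    path⇒kind (suc _) _ r = r

    -- For `d > 0` paths are bounded too, so the zigzag may start at a single vertex, without a
    -- triangle.
    vertex-lim : 0 < d → s + 3 ≤ length P + length P → ∃ (_∈ P) → 0 < length R → 1 + (length R + d) ≤ s
    vertex-lim d>0 big (x , x∈) = go R refl
      where
      go : ∀ R′ → R′ ≡ R → 0 < length R′ → 1 + (length R′ + d) ≤ s
      go (c ∷ cs) refl _
        with zigzag complete disjoint P! R! (proj₂ (split-off {xs = x ∷ []} (∉⇒Unique (λ ()) []) (cons-⊆ x∈ (λ ()))))
               (ext (trans (col-sym c x) (complete x∈ (here refl))) (one x))
      ... | n , rn , inj₁ le = bound-single n d (length cs) s le (lim (path⇒kind d d>0 (in-V rn)))
      ... | n , rn , inj₂ le = contradiction (bound-single-absurd n d (length P) s le (lim (path⇒kind d d>0 (in-V rn))) big)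
        λ ()

    -- Each connector lowers the bound on the paths of the large side by one.
    join : 3 ≤ s → s + 3 ≤ length P + length P → ∃ (_∈ P) →
           (length R + d < s × Lim s e (length R + d) P) ⊎ (d ≡ 0 × s ≤ length R × NoEdge e P)
    join 3≤s big P∋ with length R | (λ {l} → path-lim {l} big) | (λ d>0 → vertex-lim d>0 big P∋)
    -- Without connectors the deficit stays the same, and so does the kind of rope that it bounds.
    ... | zero | _ | _ = inj₁ (d<s d lim , lim ∘ widen P⊆V)
      where
      d<s : ∀ d → Lim s e d V → d < s
      d<s zero _ = ≤-trans (s≤s z≤n) 3≤s
      d<s (suc d) lim = lim (rope refl (∉⇒Unique (λ ()) []) (cons-⊆ (P⊆V (proj₂ P∋)) λ ()) (one _))
    ... | suc ρ | long | single with suc (suc ρ + d) ≤? s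
    ...   | yes lt = inj₁ (lt , λ { {zero} _ → <⇒≤ lt ; {suc zero} _ → lt ; {suc (suc _)} r → long (s≤s z≤n) r })
    -- Here `vertex-lim` forces `d` to be 0, and an edge of `P` would be a path on two vertices, for
    -- which `path-lim` gives the negated bound.
    ...   | no ¬lt = inj₂ (d≡0 d (λ d>0 → ¬lt (single d>0 (s≤s z≤n))) , s≤ρ , λ y∈ z∈ ne yz →
              ¬lt (≤-trans (n≤1+n _) (long (s≤s z≤n) (rope refl
                     (∉⇒Unique (λ { (here p) → ne p ; (there ()) }) (∉⇒Unique (λ ()) []))
                     (cons-⊆ y∈ (cons-⊆ z∈ λ ())) (ext yz (one _))))))
      where
      d≡0 : ∀ d → ¬ 0 < d → d ≡ 0
      d≡0 zero _ = refl
      d≡0 (suc d) ¬p = contradiction (s≤s z≤n) ¬p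
      s≤ρ : s ≤ suc ρ
      s≤ρ = subst (s ≤_) (trans (cong (suc ρ +_) (d≡0 d (λ d>0 → ¬lt (single d>0 (s≤s z≤n))))) (+-identityʳ (suc ρ))) (≮⇒≥ ¬lt)

  -- The zigzag from an edge of `P` has at least `2 * length R + 2` or at least `2 * length P - 1`
  -- vertices, in both cases more than `s`. In applications `R` is a large class, or the part of one
  -- among the links, and `P` consists of neighbours.
  no-edge : ∀ {s e} {V P R : List A} → Lim s e 0 V → Unique P → Unique R → P ⊆ V → R ⊆ V →
    Complete e P R → (∀ {v} → v ∈ P → v ∉ R) → 0 < length R →
    s + 2 ≤ length P + length P → s ≤ length R + length R + 1 → NoEdge e P
  no-edge {s} {e} {V} {P} {R} lim P! R! P⊆V R⊆V com dis ρ>0 bigP bigR x∈ y∈ ne xy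
    with Joined.edge-zigzag lim P! R! P⊆V R⊆V com dis x∈ y∈ ne xy ρ>0
  ... | n , rn , inj₁ le = contradiction (edge-absurd₁ n (length R) s le 
      (Joined.lolly-lim lim P! R! P⊆V R⊆V com dis rn) bigR) λ ()
  ... | n , rn , inj₂ le = contradiction (edge-absurd₂ n (length P) s le 
      (Joined.lolly-lim lim P! R! P⊆V R⊆V com dis rn) bigP) λ ()

  -- Gallai partitions

  -- Connectedness is expressed as: a property that H propagates spreads over a component.
  record Components (H : A → A → Set) (V : List A) : Set₁ where
    field
      label     : A → A
      label∈    : ∀ {x} → x ∈ V → label x ∈ V
      joined    : ∀ {x y} → x ∈ V → y ∈ V → H x y → label x ≡ label y
      connected : ∀ (Q : A → Set) → (∀ {x y} → x ∈ V → y ∈ V → H x y → Q x → Q y) →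
                  ∀ {x y} → x ∈ V → y ∈ V → label x ≡ label y → Q x → Q y

  -- Vertices are added one at a time; `v` becomes the label of every component that it touches.
  components : ∀ {H : A → A → Set} → (∀ x y → Dec (H x y)) → (∀ {x y} → H x y → H y x) →
               ∀ {V} → Unique V → Components H V
  components H? H-sym {[]} _ = record { label = id ; label∈ = λ () ; joined = λ () ; connected = λ _ _ () }
  components {H} H? H-sym {v ∷ V} (v∉ ∷ V!) =
    record { label = label′ ; label∈ = label∈′ ; joined = joined′ ; connected = connected′ }
    where
    open Components (components {H} H? H-sym V!)

    Touched : A → Set
    Touched x = x ≡ v ⊎ Any (λ z → H v z × label z ≡ label x) V

    touched? : ∀ x → Dec (Touched x)
    touched? x = (x ≟ v) ⊎-dec any? (λ z → H? v z ×-dec (label z ≟ label x)) V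

    label′ : A → A
    label′ x with touched? x
    ... | yes _ = v
    ... | no _ = label x

    label∈′ : ∀ {x} → x ∈ v ∷ V → label′ x ∈ v ∷ V
    label∈′ {x} x∈ with touched? x | x∈
    ... | yes _ | _ = here refl
    ... | no ¬t | here x≡v = contradiction (inj₁ x≡v) ¬t
    ... | no _ | there x∈V = there (label∈ x∈V)

    v≢label : ∀ {x} → x ∈ v ∷ V → ¬ Touched x → v ≢ label x
    v≢label (here x≡v) ¬t = contradiction (inj₁ x≡v) ¬t
    v≢label (there x∈V) _ = All.lookup v∉ (label∈ x∈V)

    spread : ∀ {x y} → x ∈ v ∷ V → y ∈ v ∷ V → H x y → Touched x → Touched y
    spread _ (here y≡v) _ _ = inj₁ y≡v
    spread _ (there y∈V) h (inj₁ refl) = inj₂ (lose y∈V (h , refl))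
    spread (here refl) (there y∈V) h (inj₂ _) = inj₂ (lose y∈V (h , refl))
    spread (there x∈V) (there y∈V) h (inj₂ t) with find t
    ... | z , z∈ , vz , e = inj₂ (lose z∈ (vz , trans e (joined x∈V y∈V h)))

    joined′ : ∀ {x y} → x ∈ v ∷ V → y ∈ v ∷ V → H x y → label′ x ≡ label′ y
    joined′ {x} {y} x∈ y∈ h with touched? x | touched? y
    ... | yes _ | yes _ = refl
    ... | yes tx | no ¬ty = contradiction (spread x∈ y∈ h tx) ¬ty
    ... | no ¬tx | yes ty = contradiction (spread y∈ x∈ (H-sym h) ty) ¬tx
    joined′ (here x≡v) _ _ | no ¬tx | no _ = contradiction (inj₁ x≡v) ¬tx
    joined′ (there _) (here y≡v) _ | no _ | no ¬ty = contradiction (inj₁ y≡v) ¬ty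
    joined′ (there x∈V) (there y∈V) h | no _ | no _ = joined x∈V y∈V h

    module _ (Q : A → Set) (step : ∀ {x y} → x ∈ v ∷ V → y ∈ v ∷ V → H x y → Q x → Q y) where

      within : ∀ {x y} → x ∈ V → y ∈ V → label x ≡ label y → Q x → Q y
      within = connected Q (λ x∈ y∈ → step (there x∈) (there y∈))

      to-v : ∀ {x} → x ∈ v ∷ V → Touched x → Q x → Q v
      to-v _ (inj₁ refl) p = p
      to-v (here refl) _ p = p
      to-v (there x∈V) (inj₂ t) p with find t
      ... | z , z∈ , vz , e = step (there z∈) (here refl) (H-sym vz) (within x∈V z∈ (sym e) p)

      from-v : ∀ {x} → x ∈ v ∷ V → Touched x → Q v → Q x
      from-v _ (inj₁ refl) p = p
      from-v (here refl) _ p = p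
      from-v (there x∈V) (inj₂ t) p with find t
      ... | z , z∈ , vz , e = within z∈ x∈V e (step (here refl) (there z∈) vz p)

      connected′ : ∀ {x y} → x ∈ v ∷ V → y ∈ v ∷ V → label′ x ≡ label′ y → Q x → Q y
      connected′ {x} {y} x∈ y∈ e p with touched? x | touched? y
      ... | yes tx | yes ty = from-v y∈ ty (to-v x∈ tx p)
      ... | yes _ | no ¬ty = contradiction e (v≢label y∈ ¬ty)
      ... | no ¬tx | yes _ = contradiction (sym e) (v≢label x∈ ¬tx)
      connected′ (here x≡v) _ _ _ | no ¬tx | no _ = contradiction (inj₁ x≡v) ¬tx
      connected′ (there _) (here y≡v) _ _ | no _ | no ¬ty = contradiction (inj₁ y≡v) ¬ty
      connected′ (there x∈V) (there y∈V) e p | no _ | no _ = within x∈V y∈V e p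

  NoRainbow : Set
  NoRainbow = ∀ {x y z} → x ≢ y → y ≢ z → x ≢ z →
    col x y ≡ col y z ⊎ col y z ≡ col x z ⊎ col x y ≡ col x z

  module Gallai (noRainbow : NoRainbow) where

    record Cut (V : List A) : Set₁ where
      field
        a b    : C
        S      : A → Set
        S?     : Decidable S
        inner  : ∃ λ x → x ∈ V × S x
        outer  : ∃ λ y → y ∈ V × ¬ S y
        across : ∀ {x y} → x ∈ V → y ∈ V → S x → ¬ S y → col x y ≡ a ⊎ col x y ≡ b

    record Partition (V : List A) : Set where
      field
        a b         : C
        π           : A → A
        cross       : ∀ {x y} → x ∈ V → y ∈ V → π x ≢ π y → col x y ≡ a ⊎ col x y ≡ b
        homogeneous : ∀ {x y z} → x ∈ V → y ∈ V → z ∈ V → π x ≡ π y → π z ≢ π x → col z x ≡ col z y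
        nonconstant : ∃₂ λ x y → x ∈ V × y ∈ V × π x ≢ π y

    Other : C → C → A → A → Set
    Other a b x y = ¬ (col x y ≡ a ⊎ col x y ≡ b)

    other? : ∀ a b x y → Dec (Other a b x y)
    other? a b x y = ¬? ((col x y ≟ᶜ a) ⊎-dec (col x y ≟ᶜ b))

    other-sym : ∀ {a b x y} → Other a b x y → Other a b y x
    other-sym {x = x} {y} o p = o (subst (λ c → c ≡ _ ⊎ c ≡ _) (col-sym y x) p)

    -- The classes are the components of the edges with neither of the two cut colours.
    cut⇒partition : ∀ {V} → Unique V → Cut V → Partition V
    cut⇒partition {V} V! cut = record
      { a = a ; b = b ; π = label ; cross = cross ; homogeneous = homogeneous
      ; nonconstant = proj₁ inner , proj₁ outer , proj₁ (proj₂ inner) , proj₁ (proj₂ outer) ,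
          λ e → proj₂ (proj₂ outer) (connected S closed (proj₁ (proj₂ inner)) (proj₁ (proj₂ outer)) e (proj₂ (proj₂ inner))) }
      where
      open Cut cut
      open Components (components (other? a b) other-sym V!)

      closed : ∀ {x y} → x ∈ V → y ∈ V → Other a b x y → S x → S y
      closed {y = y} x∈ y∈ o sx with S? y
      ... | yes sy = sy
      ... | no ¬sy = contradiction (across x∈ y∈ sx ¬sy) o

      cross : ∀ {x y} → x ∈ V → y ∈ V → label x ≢ label y → col x y ≡ a ⊎ col x y ≡ b
      cross {x} {y} x∈ y∈ ne = decidable-stable ((col x y ≟ᶜ a) ⊎-dec (col x y ≟ᶜ b)) (ne ∘ joined x∈ y∈)

      homogeneous : ∀ {x y z} → x ∈ V → y ∈ V → z ∈ V → label x ≡ label y → label z ≢ label x → col z x ≡ col z y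
      homogeneous {x} {y} {z} x∈ y∈ z∈ e ne = proj₂ (connected (λ u → label x ≡ label u × col z x ≡ col z u) step x∈ y∈ e (refl , refl))
        where
        step : ∀ {u u′} → u ∈ V → u′ ∈ V → Other a b u u′ →
               label x ≡ label u × col z x ≡ col z u → label x ≡ label u′ × col z x ≡ col z u′
        step {u} {u′} u∈ u′∈ o (l , c) = l′ , trans c same
          where
          l′ = trans l (joined u∈ u′∈ o)
          same : col z u ≡ col z u′
          same with u ≟ u′
          ... | yes refl = refl
          -- The edges from `z` have colours `a` or `b` and `u u′` has neither, so the triangle
          -- escapes being rainbow only if the two edges from `z` agree.
          ... | no u≢u′ with noRainbow {z} {u} {u′} (λ { refl → ne (sym l) }) u≢u′ (λ { refl → ne (sym l′) })
          ...   | inj₁ p = contradiction (subst (λ c → c ≡ a ⊎ c ≡ b) p (cross z∈ u∈ (λ q → ne (trans q (sym l))))) o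
          ...   | inj₂ (inj₁ p) = contradiction (subst (λ c → c ≡ a ⊎ c ≡ b) (sym p) (cross z∈ u′∈ (λ q → ne (trans q (sym l′))))) o
          ...   | inj₂ (inj₂ p) = p

    -- If `v` is joined to some class in `a` and `b` only, that class is cut off. Otherwise all
    -- edges at `v` of further colours share one colour `c`. Either every edge at `v` has colour
    -- `c`, or for some `y` with `col v y ≢ c` the class of `y` is joined to the other classes in
    -- `col v y` and to `v` in `col v y` or `c`.
    extend-cut : ∀ {v V} → v ∉ V → Partition V → Cut (v ∷ V)
    extend-cut {v} {V} v∉ part = result
      where
      open Partition part
      p q : A
      p = proj₁ nonconstant
      q = proj₁ (proj₂ nonconstant)
      p∈ : p ∈ V
      p∈ = proj₁ (proj₂ (proj₂ nonconstant))
      q∈ : q ∈ V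
      q∈ = proj₁ (proj₂ (proj₂ (proj₂ nonconstant)))
      p≢q : π p ≢ π q
      p≢q = proj₂ (proj₂ (proj₂ (proj₂ nonconstant)))

      class-cut : ∀ c₁ c₂ y → y ∈ V →
        (∀ {x} → x ∈ V → π x ≡ π y → col x v ≡ c₁ ⊎ col x v ≡ c₂) →
        (∀ {x z} → x ∈ V → z ∈ V → π x ≡ π y → π z ≢ π y → col x z ≡ c₁ ⊎ col x z ≡ c₂) → Cut (v ∷ V)
      class-cut c₁ c₂ y y∈ to-v to-rest = record
        { a = c₁ ; b = c₂ ; S = λ x → x ≢ v × π x ≡ π y
        ; S? = λ x → ¬? (x ≟ v) ×-dec (π x ≟ π y)
        ; inner = y , there y∈ , (λ { refl → v∉ y∈ }) , refl
        ; outer = v , here refl , λ s → proj₁ s refl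
        ; across = across }
        where
        across : ∀ {x z} → x ∈ v ∷ V → z ∈ v ∷ V → x ≢ v × π x ≡ π y → ¬ (z ≢ v × π z ≡ π y) → col x z ≡ c₁ ⊎ col x z ≡ c₂
        across (here x≡v) _ (x≢v , _) _ = contradiction x≡v x≢v
        across (there x∈) (here refl) (_ , e) _ = to-v x∈ e
        across (there x∈) (there z∈) (_ , e) ¬s = to-rest x∈ z∈ e λ e′ → ¬s ((λ { refl → v∉ z∈ }) , e′)

      result : Cut (v ∷ V)
      result with any? (λ x → ¬? (any? (λ y → (π y ≟ π x) ×-dec other? a b v y) V)) V
      ... | yes some with find some
      ...   | x , x∈ , untouched = class-cut a b x x∈
              (λ {y} y∈ e → decidable-stable ((col y v ≟ᶜ a) ⊎-dec (col y v ≟ᶜ b))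
                 (λ o → untouched (lose y∈ (e , other-sym {a} {b} {y} {v} o))))
              (λ x′∈ z∈ e ne → cross x′∈ z∈ λ e′ → ne (trans (sym e′) e))
      result | no none = result′
        where
        v≢ : ∀ {x} → x ∈ V → v ≢ x
        v≢ x∈ refl = v∉ x∈

        touch : ∀ {x} → x ∈ V → ∃ λ y → y ∈ V × π y ≡ π x × Other a b v y
        touch {x} x∈ = find (decidable-stable (any? (λ y → (π y ≟ π x) ×-dec other? a b v y) V) (λ n → none (lose x∈ n)))

        agree : ∀ {x y} → x ∈ V → y ∈ V → π x ≢ π y → Other a b v x → Other a b v y → col v x ≡ col v y
        agree x∈ y∈ ne ox oy with noRainbow (v≢ x∈) (λ { refl → ne refl }) (v≢ y∈)
        ... | inj₁ e = contradiction (subst (λ c → c ≡ a ⊎ c ≡ b) (sym e) (cross x∈ y∈ ne)) ox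
        ... | inj₂ (inj₁ e) = contradiction (subst (λ c → c ≡ a ⊎ c ≡ b) e (cross x∈ y∈ ne)) oy
        ... | inj₂ (inj₂ e) = e

        p′ = proj₁ (touch p∈)
        p′∈ = proj₁ (proj₂ (touch p∈))
        p′~p = proj₁ (proj₂ (proj₂ (touch p∈)))
        op′ = proj₂ (proj₂ (proj₂ (touch p∈)))
        c = col v p′

        uniform : ∀ {y} → y ∈ V → Other a b v y → col v y ≡ c
        uniform {y} y∈ oy with π y ≟ π p
        ... | no ne = agree y∈ p′∈ (λ e → ne (trans e p′~p)) oy op′
        -- Both `y` and `p′` lie in the class of `p`, so they are compared through a vertex of the
        -- class of `q`.
        ... | yes e with touch q∈
        ...   | q′ , q′∈ , q′~q , oq′ = trans
                (agree y∈ q′∈ (λ e′ → p≢q (trans (sym e) (trans e′ q′~q))) oy oq′)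
                (agree q′∈ p′∈ (λ e′ → p≢q (trans (sym p′~p) (trans (sym e′) q′~q))) oq′ op′)

        outsider : ∀ y → ∃ λ w → w ∈ V × π w ≢ π y × Other a b v w
        outsider y with π y ≟ π p | touch q∈
        ... | no ne | _ = p′ , p′∈ , (λ e → ne (trans (sym e) p′~p)) , op′
        ... | yes e | q′ , q′∈ , q′~q , oq′ = q′ , q′∈ , (λ e′ → p≢q (trans (sym e) (trans (sym e′) q′~q))) , oq′

        -- An edge at v of colour ≠ c repeats the colour between its class and any other.
        copy : ∀ {x w} → x ∈ V → w ∈ V → π w ≢ π x → Other a b v w → col v x ≢ c → col v x ≡ col w x
        copy {x} {w} x∈ w∈ ne ow x≢c with noRainbow {v} {w} {x} (v≢ w∈) (λ { refl → ne refl }) (v≢ x∈)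
        ... | inj₁ e = contradiction (subst (λ c → c ≡ a ⊎ c ≡ b) (sym e) (cross w∈ x∈ ne)) ow
        ... | inj₂ (inj₁ e) = sym e
        ... | inj₂ (inj₂ e) = contradiction (trans (sym e) (uniform w∈ ow)) x≢c

        result′ : Cut (v ∷ V)
        result′ with any? (λ y → ¬? (col v y ≟ᶜ c)) V
        ... | no all-c = record
                { a = c ; b = c ; S = _≡ v ; S? = _≟ v
                ; inner = v , here refl , refl
                ; outer = p , there p∈ , λ e → v≢ p∈ (sym e)
                ; across = λ { _ (here e) _ ne → contradiction e ne
                             ; {y = y} _ (there y∈) refl _ → inj₁ (decidable-stable (col v y ≟ᶜ c) λ n → all-c (lose y∈ n)) } }
        ... | yes some with find some
        ...   | y , y∈ , y≢c = class-cut (col v y) c y y∈ to-v to-rest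
          where
          to-v : ∀ {x} → x ∈ V → π x ≡ π y → col x v ≡ col v y ⊎ col x v ≡ c
          to-v {x} x∈ e with col v x ≟ᶜ c | outsider y
          ... | yes p | _ = inj₂ (trans (col-sym x v) p)
          ... | no x≢c | w , w∈ , ne , ow = inj₁ (trans (col-sym x v)
                (trans (copy x∈ w∈ (λ p → ne (trans p e)) ow x≢c)
                  (trans (homogeneous x∈ y∈ w∈ e (λ p → ne (trans p e))) (sym (copy y∈ w∈ ne ow y≢c)))))
          to-rest : ∀ {x z} → x ∈ V → z ∈ V → π x ≡ π y → π z ≢ π y → col x z ≡ col v y ⊎ col x z ≡ c
          to-rest {x} {z} x∈ z∈ e ne with touch z∈
          ... | z′ , z′∈ , z′~z , oz′ = inj₁ (trans
                (homogeneous z∈ z′∈ x∈ (sym z′~z) (λ p → ne (trans (sym p) e)))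
                (trans (col-sym x z′) (trans (homogeneous x∈ y∈ z′∈ e (λ p → ne (trans (sym z′~z) (trans p e))))
                  (sym (copy y∈ z′∈ (λ p → ne (trans (sym z′~z) p)) oz′ y≢c)))))

    cut-exists : ∀ {V} → Unique V → 2 ≤ length V → Cut V
    cut-exists {x ∷ []} _ (s≤s ())
    cut-exists {x ∷ y ∷ []} ((x≢y ∷ []) ∷ _) _ = record
      { a = col x y ; b = col x y ; S = _≡ x ; S? = _≟ x
      ; inner = x , here refl , refl ; outer = y , there (here refl) , x≢y ∘ sym
      ; across = λ { _ (here e) _ ne → contradiction e ne
                   ; _ (there (here refl)) refl _ → inj₁ refl } }
    cut-exists {x ∷ V@(_ ∷ _ ∷ _)} (x∉ ∷ V!) _ =
      extend-cut (λ x∈ → All.lookup x∉ x∈ refl) (cut⇒partition V! (cut-exists V! (s≤s (s≤s z≤n))))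

    gallai-partition : ∀ {V} → Unique V → 2 ≤ length V → Partition V
    gallai-partition V! le = cut⇒partition V! (cut-exists V! le)

  -- The upper bound

  palette : List (C × ℕ) → List C
  palette = map proj₁

  deficit : List (C × ℕ) → ℕ
  deficit K = sum (map proj₂ K)

  module Bound (noRainbow : NoRainbow) (s : ℕ) (3≤s : 3 ≤ s) where

    open Gallai noRainbow

    record Valid (V : List A) (K : List (C × ℕ)) : Set where
      constructor valid
      field
        coloured : ∀ {x y} → x ∈ V → y ∈ V → x ≢ y → col x y ∈ palette K
        limited  : ∀ {e d} → (e , d) ∈ K → Lim s e d V

    -- For positive `d` a single vertex already counts as a path, whence `1 + d ≤ s`.
    d<s : ∀ {e d V} → ∃ (_∈ V) → Lim s e d V → d < s
    d<s {d = zero} _ _ = ≤-trans (s≤s z≤n) 3≤s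
    d<s {d = suc d} (x , x∈) lim = lim (rope refl (∉⇒Unique (λ ()) []) (cons-⊆ x∈ λ ()) (one x))

    deficit-bound : ∀ {V} → ∃ (_∈ V) → ∀ K → (∀ {e d} → (e , d) ∈ K → Lim s e d V) →
                    deficit K + length K ≤ length K * s
    deficit-bound {V} _ [] _ = ≤-refl {0}
    deficit-bound V∋ ((e , d) ∷ K) lims = sum-step d (deficit K) s (length K) (length K * s)
      (d<s V∋ (lims (here refl))) (deficit-bound V∋ K (lims ∘ there))

    class-of-id≤ : ∀ {V : List A} → Unique V → ∀ x → length (filter (λ y → y ≟ x) V) ≤ 1
    class-of-id≤ {V} V! x = length-mono-⊆ {ys = x ∷ []} (Uniq.filter⁺ (_≟ x) V!) λ y∈ → here (proj₂ (∈-filter⁻ (_≟ x) {xs = V} y∈))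

    -- Splitting off `k` makes `length K` the number of colours minus one, the argument that `h`
    -- takes.
    Bounded : List A → Set
    Bounded V = ∀ k K → Unique (palette (k ∷ K)) → Valid V (k ∷ K) → length V + deficit (k ∷ K) ≤ s * h (length K)

    one-colour : ∀ {V e d} → Unique V → ∃ (_∈ V) → Valid V ((e , d) ∷ []) → length V + (d + 0) ≤ s * 1
    one-colour {V} {e} {d} V! V∋ (valid coloured limited) = ≤-trans (≤-reflexive (cong (length V +_) (+-identityʳ d)))
        (≤-trans (go d (limited (here refl))) (≤-reflexive (sym (*-identityʳ s))))
      where
      cross : ∀ {x y} → x ∈ V → y ∈ V → x ≢ y → col x y ≡ e
      cross x∈ y∈ ne with coloured x∈ y∈ ne
      ... | here p = p
      module PV = Parts V V! id 0 (class-of-id≤ V!)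
      open PV.Monochromatic e cross
      nonempty : 1 ≤ length V
      nonempty = ∈-length (proj₂ V∋)
      go : ∀ d → Lim s e d V → length V + d ≤ s
      go zero lim with 3 ≤? length V
      ... | yes 3≤ = lim (greedy (length V) nonempty (≤-reflexive (+-identityʳ _)) λ _ → 3≤ , 3≤)
      ... | no ¬3≤ = ≤-trans (≤-reflexive (+-identityʳ _)) (≤-trans (<⇒≤ (≰⇒> ¬3≤)) 3≤s)
      go (suc d) lim = lim (greedy (length V) nonempty (≤-reflexive (+-identityʳ _)) λ ())

    -- Every vertex is a class of its own, so `q` is 0 and homogeneity is trivial.
    two-colour : ∀ {V red blue d₁ d₂} → Unique V → ∃ (_∈ V) → Valid V ((red , d₁) ∷ (blue , d₂) ∷ []) →
                 length V + (d₁ + (d₂ + 0)) ≤ s * 2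
    two-colour {V} {red} {blue} {d₁} {d₂} V! V∋ (valid coloured limited) = ≮⇒≥ λ lt →
      two-colours cross 3≤s (limited (here refl)) (limited (there (here refl))) V∋
        (pair-room₁ (length V) d₁ d₂ s lt) λ { refl refl → pair-room₂ (length V) s lt 3≤s }
      where
      cross : ∀ {x y} → x ∈ V → y ∈ V → x ≢ y → col x y ≡ red ⊎ col x y ≡ blue
      cross x∈ y∈ ne with coloured x∈ y∈ ne
      ... | here p = inj₁ p
      ... | there (here p) = inj₂ p
      homogeneous : ∀ {x y z} → x ∈ V → y ∈ V → z ∈ V → x ≡ y → z ≢ x → col z x ≡ col z y
      homogeneous _ _ _ refl _ = refl
      open TwoColours V V! id 0 (class-of-id≤ V!) homogeneous

    -- K′ = k ∷ K lists the colours other than the two of the partition.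
    module Step (V : List A) (V! : Unique V) (ih : ∀ W → length W < length V → Unique W → ∃ (_∈ W) → Bounded W)
      (π : A → A) (homogeneous : ∀ {x y z} → x ∈ V → y ∈ V → z ∈ V → π x ≡ π y → π z ≢ π x → col z x ≡ col z y)
      (nonconstant : ∃₂ λ x y → x ∈ V × y ∈ V × π x ≢ π y)
      (k : C × ℕ) (K : List (C × ℕ)) where

      K′ = k ∷ K
      T = deficit K′
      G = s * h (length K)

      class : A → List A
      class x = filter (λ y → π y ≟ π x) V

      class⊆ : ∀ {x} → class x ⊆ V
      class⊆ {x} = proj₁ ∘ ∈-filter⁻ (λ y → π y ≟ π x)

      class! : ∀ {x} → Unique (class x)
      class! {x} = Uniq.filter⁺ (λ y → π y ≟ π x) V!

      class-label : ∀ {x y} → y ∈ class x → π y ≡ π x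
      class-label {x} y∈ = proj₂ (∈-filter⁻ (λ y → π y ≟ π x) {xs = V} y∈)

      self∈ : ∀ {x} → x ∈ V → x ∈ class x
      self∈ {x} x∈ = ∈-filter⁺ (λ y → π y ≟ π x) x∈ refl

      proper : ∀ {W z} → Unique W → W ⊆ V → z ∈ V → z ∉ W → length W < length V
      proper W! W⊆ z∈ z∉ = length-mono-⊆ (∉⇒Unique z∉ W!) (cons-⊆ z∈ W⊆)

      class< : ∀ x → length (class x) < length V
      class< x = go nonconstant
        where
        go : (∃₂ λ y z → y ∈ V × z ∈ V × π y ≢ π z) → length (class x) < length V
        go (y , z , y∈ , z∈ , ne) with π y ≟ π x
        ... | no y≢x = proper class! class⊆ y∈ (λ y∈c → y≢x (class-label y∈c))
        ... | yes e = proper class! class⊆ z∈ (λ z∈c → ne (trans e (sym (class-label z∈c))))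

      -- The hypothesis concerns vertices of `O` only, so a class given by an arbitrary `y` is
      -- renamed after one of its members. `O` is the whole of `V` or a set of links.
      classes≤ : ∀ {O q} → Unique O → s ≤ q + q + 1 →
        (∀ {w} → w ∈ O → let X = filter (λ z → π z ≟ π w) O in ¬ (s + 3 ≤ length X + length X)) →
        ∀ y → length (filter (λ z → π z ≟ π y) O) ≤ suc q
      classes≤ {O} {q} O! ≤q small y with filter (λ z → π z ≟ π y) O in eq
      ... | [] = z≤n
      ... | w ∷ ws with ∈-filter⁻ (λ z → π z ≟ π y) {xs = O} (subst (w ∈_) (sym eq) (here refl))
      ...   | w∈ , e = half-class s q _ (≰⇒> λ big → small w∈ (≤-trans big (+-mono-≤ same same))) ≤q
        where
        same : suc (length ws) ≤ length (filter (λ z → π z ≟ π w) O)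
        same = subst (λ l → length l ≤ _) eq (length-mono-⊆ (Uniq.filter⁺ (λ z → π z ≟ π y) O!)
          λ v∈ → let v∈O , e′ = ∈-filter⁻ (λ z → π z ≟ π y) {xs = O} v∈ in ∈-filter⁺ (λ z → π z ≟ π w) v∈O (trans e′ (sym e)))

      module Side (red blue : C) (d₁ d₂ : ℕ) (red! : Unique (palette ((red , d₁) ∷ (blue , d₂) ∷ K′)))
        (val : Valid V ((red , d₁) ∷ (blue , d₂) ∷ K′))
        (cross : ∀ {x y} → x ∈ V → y ∈ V → π x ≢ π y → col x y ≡ red ⊎ col x y ≡ blue) where

        open Valid val

        red-lim : Lim s red d₁ V
        red-lim = limited (here refl)

        blue-lim : Lim s blue d₂ V
        blue-lim = limited (there (here refl))

        Link? = λ x y → ¬? (π y ≟ π x) ×-dec (col y x ≟ᶜ red)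

        links : A → List A
        links x = filter (Link? x) V

        links⊆ : ∀ {x} → links x ⊆ V
        links⊆ {x} = proj₁ ∘ ∈-filter⁻ (Link? x)

        links! : ∀ {x} → Unique (links x)
        links! {x} = Uniq.filter⁺ (Link? x) V!

        links-complete : ∀ {x} → x ∈ V → Complete red (class x) (links x)
        links-complete {x} x∈ {p} {r} p∈ r∈
          with ∈-filter⁻ (λ y → π y ≟ π x) p∈ | ∈-filter⁻ (Link? x) r∈
        ... | p∈V , e | r∈V , ne , c = trans (col-sym p r) (trans (sym (homogeneous x∈ p∈V r∈V (sym e) ne)) c)

        links-disjoint : ∀ {x v} → v ∈ class x → v ∉ links x
        links-disjoint {x} v∈ v∈′ = proj₁ (proj₂ (∈-filter⁻ (Link? x) {xs = V} v∈′)) (class-label v∈)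

        -- A zigzag that uses up a large class exceeds `s`, and a class that is not large has at
        -- most `q + 1` vertices, where `q` is half of `s` rounded down.
        Large : A → Set
        Large x = s + 3 ≤ length (class x) + length (class x)

        join-class : ∀ {x} → x ∈ V → Large x →
          (length (links x) + d₁ < s × Lim s red (length (links x) + d₁) (class x)) ⊎
          (d₁ ≡ 0 × s ≤ length (links x) × NoEdge red (class x))
        join-class {x} x∈ big = Joined.join red-lim class! links! class⊆ links⊆ (links-complete x∈) links-disjoint
          3≤s big (x , self∈ x∈)

        links-no-edge : ∀ {x} → x ∈ V → Large x → s ≤ length (links x) → d₁ ≡ 0 → NoEdge red (links x)
        links-no-edge {x} x∈ big s≤ refl = no-edge red-lim links! class! links⊆ class⊆
          (λ {p} {r} p∈ r∈ → trans (col-sym p r) (links-complete x∈ r∈ p∈)) (λ v∈ v∈′ → links-disjoint v∈′ v∈)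
          (∈-length (self∈ x∈)) (twice-large s (length (links x)) 3≤s s≤) (large-odd s (length (class x)) big)

        without-red : ∀ {W d} → W ⊆ V → NoEdge red W → Lim s blue d W → Valid W ((blue , d) ∷ K′)
        without-red {W} {d} W⊆ none lim = valid colours lims
          where
          colours : ∀ {x y} → x ∈ W → y ∈ W → x ≢ y → col x y ∈ palette ((blue , d) ∷ K′)
          colours x∈ y∈ ne with coloured (W⊆ x∈) (W⊆ y∈) ne
          ... | here p = contradiction p (none x∈ y∈ ne)
          ... | there p = p
          lims : ∀ {e d′} → (e , d′) ∈ (blue , d) ∷ K′ → Lim s e d′ W
          lims (here refl) = lim
          lims (there p) = limited (there (there p)) ∘ widen W⊆

        without-both : ∀ {W} → W ⊆ V → NoEdge red W → NoEdge blue W → Valid W K′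
        without-both {W} W⊆ none₁ none₂ = valid colours (λ p → limited (there (there p)) ∘ widen W⊆)
          where
          colours : ∀ {x y} → x ∈ W → y ∈ W → x ≢ y → col x y ∈ palette K′
          colours x∈ y∈ ne with coloured (W⊆ x∈) (W⊆ y∈) ne
          ... | here p = contradiction p (none₁ x∈ y∈ ne)
          ... | there (here p) = contradiction p (none₂ x∈ y∈ ne)
          ... | there (there p) = p

        links< : ∀ {x} → x ∈ V → length (links x) < length V
        links< {x} x∈ = proper links! links⊆ x∈ λ x∈l → links-disjoint (self∈ x∈) x∈l

        blue! : Unique (palette ((blue , d₂) ∷ K′))
        blue! = AllPairs.tail red!

        links-bound : ∀ {x} → x ∈ V → Large x → s ≤ length (links x) → d₁ ≡ 0 →
                      length (links x) + (d₂ + T) ≤ s * h (suc (length K))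
        links-bound x∈ big s≤ e = ih _ (links< x∈) links! (inhabited (≤-trans (≤-trans (s≤s z≤n) 3≤s) s≤))
          (blue , d₂) K′ blue! (without-red links⊆ (links-no-edge x∈ big s≤ e) (blue-lim ∘ widen links⊆))

        class-bound : ∀ {x d} → x ∈ V → NoEdge red (class x) → Lim s blue d (class x) →
                      length (class x) + (d + T) ≤ s * h (suc (length K))
        class-bound {x} {d} x∈ none lim = ih _ (class< x) class! (x , self∈ x∈)
          (blue , d) K′ blue! (without-red class⊆ none lim)

        Light : List A → Set
        Light W = length W + T ≤ G

        light : ∀ {W z} → ∃ (_∈ W) → Unique W → W ⊆ V → z ∈ V → z ∉ W → NoEdge red W → NoEdge blue W → Light W
        light W∋ W! W⊆ z∈ z∉ none₁ none₂ =
          ih _ (proper W! W⊆ z∈ z∉) W! W∋ k K (AllPairs.tail blue!) (without-both W⊆ none₁ none₂)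

        s≤G : s ≤ G
        s≤G = ≤-trans (≤-reflexive (sym (*-identityʳ s))) (*-monoʳ-≤ s (≤-trans (s≤s z≤n) (n<h (length K))))

        -- The links span no red edge. If they contain a large part `X` of a class, `X` spans
        -- neither red nor blue and is blue to the rest `Y`, which has fewer than `s` vertices or
        -- spans no blue either; both parts are at most `G`. If they contain none, more than `2 * s`
        -- links would hold a blue lollipop of size `s + 1`.
        links-small : ∀ {x q} → x ∈ V → Large x → s ≤ length (links x) → d₁ ≡ 0 → d₂ ≡ 0 → q + q ≤ s → s ≤ q + q + 1 →
          (∀ {y} → y ∈ V → Large y → NoEdge red (class y) × NoEdge blue (class y)) → length (links x) ≤ G + G
        links-small {x} {q} x∈ big s≤ refl refl q≤ ≤q sparse
          with any? (λ y → let X = filter (λ z → π z ≟ π y) (links x) in s + 3 ≤? length X + length X) (links x)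
        ... | yes some with find some
        ...   | y , y∈ , large = side-sum (length (links x)) (length X) (length Y) T (proj₁ Y-bound) G count
                  (light (y , y∈X) X! (links⊆ ∘ X⊆) x∈ (x∉ ∘ X⊆)
                    (λ p∈ q∈ → proj₁ (sparse (links⊆ y∈) large′) (X⊆class p∈) (X⊆class q∈))
                    (λ p∈ q∈ → proj₂ (sparse (links⊆ y∈) large′) (X⊆class p∈) (X⊆class q∈)))
                  (proj₂ Y-bound)
          where
          X? = λ z → π z ≟ π y
          Y? = λ z → ¬? (π z ≟ π y)
          X = filter X? (links x)
          Y = filter Y? (links x)
          X! = Uniq.filter⁺ X? (links! {x})
          Y! = Uniq.filter⁺ Y? (links! {x})
          X⊆ : X ⊆ links x
          X⊆ = proj₁ ∘ ∈-filter⁻ X?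
          Y⊆ : Y ⊆ links x
          Y⊆ = proj₁ ∘ ∈-filter⁻ Y?
          y∈X = ∈-filter⁺ X? y∈ refl
          x∉ : x ∉ links x
          x∉ = links-disjoint (self∈ x∈)
          X⊆class : X ⊆ class y
          X⊆class z∈ = ∈-filter⁺ X? (links⊆ (X⊆ z∈)) (proj₂ (∈-filter⁻ X? {xs = links x} z∈))
          large′ : Large y
          large′ = ≤-trans large (+-mono-≤ (length-mono-⊆ X! X⊆class) (length-mono-⊆ X! X⊆class))

          count : length (links x) ≤ length X + length Y
          count = ≤-trans (length-mono-⊆ (links! {x}) cov) (≤-reflexive (length-++ X))
            where
            cov : links x ⊆ X ++ Y
            cov {z} z∈ with π z ≟ π y
            ... | yes e = ∈-++⁺ˡ (∈-filter⁺ X? z∈ e)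
            ... | no ne = ∈-++⁺ʳ X (∈-filter⁺ Y? z∈ ne)

          red-free : NoEdge red (links x)
          red-free = links-no-edge x∈ big s≤ refl

          YX-blue : Complete blue Y X
          YX-blue {p} {r} p∈ r∈ with ∈-filter⁻ X? {xs = links x} r∈ | ∈-filter⁻ Y? {xs = links x} p∈
          ... | r∈l , e | p∈l , ne with cross (links⊆ p∈l) (links⊆ r∈l) (λ e′ → ne (trans e′ e))
          ...   | inj₁ c = contradiction c (red-free p∈l r∈l λ { refl → ne e })
          ...   | inj₂ c = c

          -- `T₁` is 0 for a small `Y`, which is bounded through `s ≤ G` without regard to deficits.
          Y-bound : ∃ λ T₁ → length Y + T₁ ≤ G
          Y-bound with s ≤? length Y
          ... | no ¬le = 0 , ≤-trans (≤-reflexive (+-identityʳ _)) (≤-trans (<⇒≤ (≰⇒> ¬le)) s≤G)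
          ... | yes le = T , light (inhabited (≤-trans (≤-trans (s≤s z≤n) 3≤s) le)) Y! (links⊆ ∘ Y⊆) x∈ (x∉ ∘ Y⊆)
                (λ p∈ q∈ → red-free (Y⊆ p∈) (Y⊆ q∈))
                (no-edge blue-lim Y! X! (links⊆ ∘ Y⊆) (links⊆ ∘ X⊆) YX-blue
                  (λ v∈Y v∈X → proj₂ (∈-filter⁻ Y? {xs = links x} v∈Y) (proj₂ (∈-filter⁻ X? {xs = links x} v∈X)))
                  (∈-length y∈X) (twice-large s (length Y) 3≤s le) (large-odd s (length X) large))
        links-small {x} {q} x∈ big s≤ refl refl q≤ ≤q sparse | no none with suc (s + s) ≤? length (links x)
        ... | no ¬le = ≤-trans (s≤s⁻¹ (≰⇒> ¬le)) (+-mono-≤ s≤G s≤G)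
        ... | yes le = contradiction (blue-lim (widen links⊆ (greedy (suc s) (s≤s z≤n) (greedy-room₁ s q _ le q≤ 3≤s)
                  λ _ → ≤-trans 3≤s (n≤1+n s) , greedy-room₂ s q _ le q≤ 3≤s)))
                  (<⇒≱ (≤-reflexive (cong suc (sym (+-identityʳ s)))))
          where
          blue-cross : ∀ {y z} → y ∈ links x → z ∈ links x → π y ≢ π z → col y z ≡ blue
          blue-cross y∈ z∈ ne with cross (links⊆ y∈) (links⊆ z∈) ne
          ... | inj₁ c = contradiction c (links-no-edge x∈ big s≤ refl y∈ z∈ λ { refl → ne refl })
          ... | inj₂ c = c
          module PL = Parts (links x) links! π q (classes≤ (links! {x}) ≤q (λ y∈ big′ → none (lose y∈ big′)))
          open PL.Monochromatic blue blue-cross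

      module Both (red blue : C) (d₁ d₂ : ℕ) (distinct : Unique (palette ((red , d₁) ∷ (blue , d₂) ∷ K′)))
        (val : Valid V ((red , d₁) ∷ (blue , d₂) ∷ K′))
        (cross : ∀ {x y} → x ∈ V → y ∈ V → π x ≢ π y → col x y ≡ red ⊎ col x y ≡ blue)
        (V∋ : ∃ (_∈ V)) where

        open Valid val

        swapped : ∀ {B : Set} {x y : B} {xs} → x ∷ y ∷ xs ↭ y ∷ x ∷ xs
        swapped = swap↭ _ _ ↭-refl

        module RB = Side red blue d₁ d₂ distinct val cross
        module BR = Side blue red d₂ d₁ (Unique-resp-↭ swapped distinct)
          (valid (λ x∈ y∈ ne → ∈-resp-↭ swapped (coloured x∈ y∈ ne)) (λ p → limited (∈-resp-↭ swapped p)))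
          (λ x∈ y∈ ne → swap (cross x∈ y∈ ne))

        Goal : Set
        Goal = length V + (d₁ + (d₂ + T)) ≤ s * (5 * h (length K))

        count : ∀ x → x ∈ V → length V ≤ length (class x) + (length (RB.links x) + length (BR.links x))
        count x x∈ = ≤-trans (length-mono-⊆ V! cov) (≤-reflexive (trans (length-++ (class x))
            (cong (length (class x) +_) (length-++ (RB.links x)))))
          where
          cov : V ⊆ class x ++ RB.links x ++ BR.links x
          cov {y} y∈ with π y ≟ π x
          ... | yes e = ∈-++⁺ˡ (∈-filter⁺ (λ y → π y ≟ π x) y∈ e)
          ... | no ne with cross y∈ x∈ ne
          ...   | inj₁ c = ∈-++⁺ʳ (class x) (∈-++⁺ˡ (∈-filter⁺ (RB.Link? x) y∈ (ne , c)))
          ...   | inj₂ c = ∈-++⁺ʳ (class x) (∈-++⁺ʳ (RB.links x) (∈-filter⁺ (BR.Link? x) y∈ (ne , c)))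

        doubling : s * h (suc (length K)) + s * h (suc (length K)) ≤ s * (5 * h (length K))
        doubling = ≤-trans (≤-reflexive (sym (*-distribˡ-+ s _ _))) (*-monoʳ-≤ s (double-h (suc (length K))))

        Sparse : A → Set
        Sparse x = d₁ ≡ 0 × d₂ ≡ 0 × s ≤ length (RB.links x) × s ≤ length (BR.links x) ×
                   NoEdge red (class x) × NoEdge blue (class x)

        -- If neither colour is excluded, all neighbours of the class turn into deficits and the
        -- induction hypothesis for the class is the goal. If one is excluded, the class, with its
        -- other neighbours as deficits, and the neighbourhood in that colour both live without the
        -- colour, and `doubling` adds their bounds.
        analyze : ∀ {x} → x ∈ V → RB.Large x → Goal ⊎ Sparse x
        analyze {x} x∈ big with RB.join-class x∈ big | BR.join-class x∈ big
        ... | inj₁ (_ , lim₁) | inj₁ (_ , lim₂) = inj₁ (dominated (length V) d₁ d₂ T (length (class x))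
                (length (RB.links x)) (length (BR.links x)) _ (count x x∈)
                (ih _ (class< x) class! (x , self∈ x∈) (red , length (RB.links x) + d₁) ((blue , length (BR.links x) + d₂) ∷ K′)
                  distinct (valid (λ p∈ q∈ → coloured (class⊆ {x} p∈) (class⊆ {x} q∈))
                    λ { (here refl) → lim₁ ; (there (here refl)) → lim₂
                      ; (there (there p)) → limited (there (there p)) ∘ widen class⊆ })))
        ... | inj₂ (refl , s≤ , none) | inj₁ (_ , lim) = inj₁ (doubled (length V) d₂ T (length (class x))
                (length (RB.links x)) (length (BR.links x)) (s * h (suc (length K))) _
                (count x x∈) (RB.class-bound x∈ none lim) (RB.links-bound x∈ big s≤ refl) doubling)
        ... | inj₁ (_ , lim) | inj₂ (refl , s≤ , none) = inj₁ (doubled (length V) d₁ T (length (class x))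
                (length (BR.links x)) (length (RB.links x)) (s * h (suc (length K))) _
                (≤-trans (count x x∈) (≤-reflexive (cong (length (class x) +_) (+-comm (length (RB.links x)) _))))
                (BR.class-bound x∈ none lim) (BR.links-bound x∈ big s≤ refl) doubling)
        ... | inj₂ (e₁ , s≤₁ , none₁) | inj₂ (e₂ , s≤₂ , none₂) = inj₂ (e₁ , e₂ , s≤₁ , s≤₂ , none₁ , none₂)

        goal : Goal
        goal with length V + (d₁ + (d₂ + T)) ≤? s * (5 * h (length K)) | half s
        ... | yes g | _ = g
        -- With the goal refuted, `analyze` must return `Sparse` for every large class, which is
        -- what `links-small` requires.
        ... | no ¬g | q , q≤ , ≤q with any? (λ x → s + 3 ≤? length (class x) + length (class x)) V
        ...   | no none = contradiction (two-colours cross 3≤s RB.red-lim RB.blue-lim V∋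
                  (small-room₁ (length V) _ d₁ d₂ T (length K) s q _ (≰⇒> ¬g) others (room s (length K)) q≤)
                  λ { refl refl → small-room₂ (length V) _ T (length K) s q _ (≰⇒> ¬g) others (room s (length K)) q≤ 3≤s })
                λ ()
          where
          others : T + suc (length K) ≤ suc (length K) * s
          others = deficit-bound V∋ K′ (λ p → limited (there (there p)))
          open TwoColours V V! π q (classes≤ V! ≤q (λ w∈ big → none (lose w∈ big))) homogeneous
        ...   | yes some with find some
        ...     | x , x∈ , big with analyze x∈ big
        ...       | inj₁ g = g
        ...       | inj₂ (refl , refl , s≤₁ , s≤₂ , none₁ , none₂) = ≤-trans
                  (quintupled (length V) T (length (class x)) (length (RB.links x)) (length (BR.links x)) G (count x x∈)
                    (RB.light (x , self∈ x∈) class! class⊆ (RB.links⊆ z∈) (λ z∈c → RB.links-disjoint z∈c z∈) none₁ none₂)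
                    (RB.links-small {q = q} x∈ big s≤₁ refl refl q≤ ≤q sparse)
                    (BR.links-small {q = q} x∈ big s≤₂ refl refl q≤ ≤q (λ y∈ large → swap× (sparse y∈ large))))
                  (≤-reflexive (five-comm s (h (length K))))
          where
          z∈ = proj₂ (inhabited (≤-trans (≤-trans (s≤s z≤n) 3≤s) s≤₁))
          sparse : ∀ {y} → y ∈ V → RB.Large y → NoEdge red (class y) × NoEdge blue (class y)
          sparse y∈ large with analyze y∈ large
          ... | inj₁ g = contradiction g ¬g
          ... | inj₂ (_ , _ , _ , _ , n₁ , n₂) = n₁ , n₂

    another : ∀ {Cs : List C} {a} → Unique Cs → 2 ≤ length Cs → ∃ λ b → b ∈ Cs × b ≢ a
    another {a = a} Cs! le = search (λ c → ¬? (c ≟ᶜ a)) Cs! (a ∷ []) le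
      λ {c} _ ¬¬e → here (decidable-stable (c ≟ᶜ a) ¬¬e)

    -- One of the two colours of a partition may fail to occur.
    two-from-palette : ∀ {Cs : List C} a b → Unique Cs → 2 ≤ length Cs → a ∈ Cs ⊎ b ∈ Cs →
      ∃₂ λ red blue → red ∈ Cs × blue ∈ Cs × red ≢ blue × (∀ {c} → c ∈ Cs → c ≡ a ⊎ c ≡ b → c ≡ red ⊎ c ≡ blue)
    two-from-palette {Cs} a b Cs! le some with member? _≟ᶜ_ a Cs | member? _≟ᶜ_ b Cs | a ≟ᶜ b
    ... | yes a∈ | yes b∈ | no a≢b = a , b , a∈ , b∈ , a≢b , λ _ p → p
    ... | yes a∈ | yes b∈ | yes refl with another {a = a} Cs! le
    ...   | c , c∈ , c≢a = a , c , a∈ , c∈ , c≢a ∘ sym , λ _ → [ inj₁ , inj₁ ]′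
    two-from-palette {Cs} a b Cs! le some | yes a∈ | no b∉ | _ with another {a = a} Cs! le
    ...   | c , c∈ , c≢a = a , c , a∈ , c∈ , c≢a ∘ sym , λ { _ (inj₁ p) → inj₁ p ; b∈ (inj₂ refl) → contradiction b∈ b∉ }
    two-from-palette {Cs} a b Cs! le some | no a∉ | yes b∈ | _ with another {a = b} Cs! le
    ...   | c , c∈ , c≢b = b , c , b∈ , c∈ , c≢b ∘ sym , λ { a∈ (inj₁ refl) → contradiction a∈ a∉ ; _ (inj₂ p) → inj₁ p }
    two-from-palette a b Cs! le some | no a∉ | no b∉ | _ = contradiction some [ a∉ , b∉ ]′

    Bounded-resp-↭ : ∀ {V k K k′ K′} → k ∷ K ↭ k′ ∷ K′ → Valid V (k ∷ K) → Unique (palette (k ∷ K)) →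
      (Unique (palette (k′ ∷ K′)) → Valid V (k′ ∷ K′) → length V + deficit (k′ ∷ K′) ≤ s * h (length K′)) →
      length V + deficit (k ∷ K) ≤ s * h (length K)
    Bounded-resp-↭ {V} perm (valid coloured limited) K! bound = subst₂ (λ d l → length V + d ≤ s * h l)
      (sym (sum-↭ (PermP.map⁺ proj₂ perm))) (sym (suc-injective (↭-length perm)))
      (bound (Unique-resp-↭ (PermP.map⁺ proj₁ perm) K!)
        (valid (λ x∈ y∈ ne → ∈-resp-↭ (PermP.map⁺ proj₁ perm) (coloured x∈ y∈ ne)) (λ p → limited (∈-resp-↭ (↭-sym perm) p))))

    -- Induction on the number of vertices for all palettes at once, since passing to a smaller set
    -- changes deficits and drops colours.
    bounded : ∀ fuel V → length V < fuel → Unique V → ∃ (_∈ V) → Bounded V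
    bounded (suc fuel) V lt V! V∋ k [] _ val = one-colour V! V∋ val
    bounded (suc fuel) V lt V! V∋ k (k₂ ∷ []) _ val = two-colour V! V∋ val
    bounded (suc fuel) V lt V! V∋ k K@(k₂ ∷ k₃ ∷ K₀) K! val with 2 ≤? length V
    -- A single vertex has no partition, but deficits below `s` already fit under
    -- `suc (length K) * s ≤ s * h (length K)` with room to spare.
    ... | no ¬2≤ = singleton-room (length V) (deficit (k ∷ K)) (length K) _ (s≤s⁻¹ (≰⇒> ¬2≤))
            (≤-trans (deficit-bound V∋ (k ∷ K) (Valid.limited val))
              (≤-trans (≤-reflexive (*-comm (suc (length K)) s)) (*-monoʳ-≤ s (n<h (length K)))))
    ... | yes 2≤ = choose (two-from-palette a b K! (s≤s (s≤s z≤n)) present)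
      where
      open Partition (gallai-partition V! 2≤)
      open Valid val

      present : a ∈ palette (k ∷ K) ⊎ b ∈ palette (k ∷ K)
      present with nonconstant
      ... | x , y , x∈ , y∈ , ne with cross x∈ y∈ ne | coloured x∈ y∈ (λ e → ne (cong π e))
      ...   | inj₁ p | c∈ = inj₁ (subst (_∈ _) p c∈)
      ...   | inj₂ p | c∈ = inj₂ (subst (_∈ palette (k ∷ K)) p c∈)

      choose : (∃₂ λ red blue → red ∈ palette (k ∷ K) × blue ∈ palette (k ∷ K) × red ≢ blue ×
                 (∀ {c} → c ∈ palette (k ∷ K) → c ≡ a ⊎ c ≡ b → c ≡ red ⊎ c ≡ blue)) →
               length V + deficit (k ∷ K) ≤ s * h (length K)
      choose (red , blue , red∈ , blue∈ , r≢b , recolour) with ∈-map⁻ proj₁ red∈ | ∈-map⁻ proj₁ blue∈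
      ... | (_ , d₁) , r∈ , refl | (_ , d₂) , b∈ , refl
        with split-off {xs = (red , d₁) ∷ (blue , d₂) ∷ []}
               (∉⇒Unique (λ { (here refl) → r≢b refl ; (there ()) }) (∉⇒Unique (λ ()) []))
               (cons-⊆ r∈ (cons-⊆ {xs = []} b∈ (λ ())))
      ...   | [] , perm = contradiction (↭-length perm) λ ()
      ...   | k′ ∷ K′ , perm = Bounded-resp-↭ perm val K! λ distinct val′ →
                Step.Both.goal V V! (λ W W< → bounded fuel W (≤-trans W< (s≤s⁻¹ lt))) π homogeneous nonconstant k′ K′
                  red blue d₁ d₂ distinct val′
                  (λ x∈ y∈ ne → recolour (coloured x∈ y∈ (λ e → ne (cong π e))) (cross x∈ y∈ ne)) V∋

  -- Searching for lollipops and turning them into copies of P_t^+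

  lolly? : ∀ e xs → Dec (Rope lolly e xs)
  lolly? e [] = no λ ()
  lolly? e (_ ∷ []) = no λ ()
  lolly? e (_ ∷ _ ∷ []) = no λ { (ext _ ()) }
  lolly? e (x ∷ y ∷ z ∷ []) with col x y ≟ᶜ e | col y z ≟ᶜ e | col x z ≟ᶜ e
  ... | yes p | yes q | yes r = yes (tri p q r)
  ... | no ¬p | _ | _ = no λ { (tri p _ _) → ¬p p ; (ext p _) → ¬p p }
  ... | yes _ | no ¬q | _ = no λ { (tri _ q _) → ¬q q ; (ext _ (ext _ ())) }
  ... | yes _ | yes _ | no ¬r = no λ { (tri _ _ r) → ¬r r ; (ext _ (ext _ ())) }
  lolly? e (w ∷ x ∷ xs@(_ ∷ _ ∷ _)) with col w x ≟ᶜ e | lolly? e (x ∷ xs)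
  ... | yes p | yes r = yes (ext p r)
  ... | no ¬p | _ = no λ { (ext p _) → ¬p p }
  ... | yes _ | no ¬r = no λ { (ext _ r) → ¬r r }

  -- Free ends are dropped one by one; `3 ≤ n` stops this before the triangle would have to be
  -- broken.
  shorten : ∀ {e V} j {n} → 3 ≤ n → RopeIn lolly e V (j + n) → RopeIn lolly e V n
  shorten zero _ r = r
  shorten (suc j) {n} 3≤n (rope {x ∷ xs} len u s r) with shrink r
  ... | inj₁ r′ = shorten j 3≤n (rope (suc-injective len) (AllPairs.tail u) (s ∘ there) r′)
  ... | inj₂ (_ , two) = contradiction
    (≤-trans 3≤n (≤-trans (m≤n+m n j) (≤-reflexive (trans (sym (suc-injective len)) two)))) λ { (s≤s (s≤s ())) }

  rope-edge : ∀ {κ e xs} → Rope κ e xs → ∀ p q → suc (toℕ p) ≡ toℕ q → col (lookup xs p) (lookup xs q) ≡ e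
  rope-edge (one _) zero zero ()
  rope-edge (tri c _ _) zero (suc zero) _ = c
  rope-edge (tri _ c _) (suc zero) (suc (suc zero)) _ = c
  rope-edge (tri _ _ _) (suc (suc zero)) (suc (suc zero)) ()
  rope-edge (ext c _) zero (suc zero) _ = c
  rope-edge (ext _ r) (suc p) (suc q) e = rope-edge r p q (suc-injective e)

  -- Positions are counted from the end of the list, where the triangle sits.
  lolly-chord : ∀ {e xs} → Rope lolly e xs → ∀ p q → toℕ p + 3 ≡ length xs → toℕ q + 1 ≡ length xs →
                col (lookup xs p) (lookup xs q) ≡ e
  lolly-chord (tri _ _ c) zero (suc (suc zero)) _ _ = c
  lolly-chord (tri _ _ _) (suc p) _ e _ = contradiction (m≤n+m 3 (toℕ p)) (<⇒≱ (≤-reflexive e))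
  lolly-chord (ext _ r) zero _ e _ = contradiction (lolly-length r) (<⇒≱ (≤-reflexive (sym e)))
  lolly-chord (ext _ r) (suc p) zero _ e = contradiction (lolly-length r) (<⇒≱ (≤-trans (≤-reflexive (sym e)) (s≤s z≤n)))
  lolly-chord (ext _ r) (suc p) (suc q) e e′ = lolly-chord r p q (suc-injective e) (suc-injective e′)

lookup-injective : ∀ {A : Set} {xs : List A} → Unique xs → ∀ {i j} → lookup xs i ≡ lookup xs j → i ≡ j
lookup-injective (_ ∷ _) {zero} {zero} _ = refl
lookup-injective (x∉ ∷ _) {zero} {suc j} e = contradiction e (All.lookup x∉ (∈-lookup j))
lookup-injective (x∉ ∷ _) {suc i} {zero} e = contradiction (sym e) (All.lookup x∉ (∈-lookup i))
lookup-injective (_ ∷ u) {suc i} {suc j} e = cong suc (lookup-injective u e)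

opposite-sum : ∀ {n} (i : Fin n) → toℕ (opposite i) + suc (toℕ i) ≡ n
opposite-sum i = trans (cong (_+ suc (toℕ i)) (opposite-prop i)) (m∸n+n≡m (toℕ<n i))

list? : ∀ {n} m {P : List (Fin n) → Set} → Decidable P → Dec (∃ λ xs → length xs ≡ m × P xs)
list? zero P? with P? []
... | yes p = yes ([] , refl , p)
... | no ¬p = no λ { ([] , _ , p) → ¬p p }
list? (suc m) P? with Fin.any? (λ x → list? m (λ xs → P? (x ∷ xs)))
... | yes (x , xs , len , p) = yes (x ∷ xs , cong suc len , p)
... | no ¬p = no λ { (x ∷ xs , len , p) → ¬p (x , xs , suc-injective len , p) }

module Upper {n k : ℕ} (c : EdgeColoring n (suc k)) where

  open Coloring {Fin n} {Fin (suc k)} Fin._≟_ Fin._≟_ (col c) (symm c)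

  -- `opposite` reverses the list: `MonoPtPlus` numbers vertices from the triangle, ropes from the
  -- free end.
  lolly⇒mono : ∀ {a xs} → Unique xs → Rope lolly a xs → MonoPtPlus (length xs) c
  lolly⇒mono {a} {xs} u r = lookup xs ∘ opposite , a , injective , edge , chord
    where
    injective : Injective _≡_ _≡_ (lookup xs ∘ opposite)
    injective {i} {j} e = trans (sym (opposite-involutive i))
      (trans (cong opposite (lookup-injective u e)) (opposite-involutive j))
    edge : ∀ i j → suc (toℕ i) ≡ toℕ j → col c (lookup xs (opposite i)) (lookup xs (opposite j)) ≡ a
    edge i j e = trans (symm c _ _) (rope-edge r (opposite j) (opposite i) (+-cancelʳ-≡ (suc (toℕ i)) _ _
      (trans (cong (suc (toℕ (opposite j)) +_) e) (trans (sym (+-suc (toℕ (opposite j)) (toℕ j)))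
        (trans (opposite-sum j) (sym (opposite-sum i)))))))
    chord : ∀ i j → toℕ i ≡ 0 → toℕ j ≡ 2 → col c (lookup xs (opposite i)) (lookup xs (opposite j)) ≡ a
    chord i j i≡0 j≡2 = trans (symm c _ _) (lolly-chord r (opposite j) (opposite i)
      (trans (cong (λ m → toℕ (opposite j) + suc m) (sym j≡2)) (opposite-sum j))
      (trans (cong (λ m → toℕ (opposite i) + suc m) (sym i≡0)) (opposite-sum i)))

  rainbow? : Dec (RainbowTriangle c)
  rainbow? = Fin.any? λ x → Fin.any? λ y → Fin.any? λ z →
    ¬? (x Fin.≟ y) ×-dec ¬? (y Fin.≟ z) ×-dec ¬? (x Fin.≟ z) ×-dec
    ¬? (col c x y Fin.≟ col c y z) ×-dec ¬? (col c y z Fin.≟ col c x z) ×-dec ¬? (col c x y Fin.≟ col c x z)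

  -- `GRProperty` demands a witness of one alternative, so the existence of a lollipop is decided by
  -- exhaustive search.
  lolly-of-length? : ∀ t → Dec (∃ λ a → ∃ λ xs → length xs ≡ t × Unique xs × Rope lolly a xs)
  lolly-of-length? t = Fin.any? λ a → list? t λ xs → unique? Fin._≟_ xs ×-dec lolly? a xs

  noRainbow : ¬ RainbowTriangle c → NoRainbow
  noRainbow none {x} {y} {z} x≢y y≢z x≢z
    with col c x y Fin.≟ col c y z | col c y z Fin.≟ col c x z | col c x y Fin.≟ col c x z
  ... | yes p | _ | _ = inj₁ p
  ... | no _ | yes p | _ = inj₂ (inj₁ p)
  ... | no _ | no _ | yes p = inj₂ (inj₂ p)
  ... | no p | no q | no r = contradiction (x , y , z , x≢y , y≢z , x≢z , p , q , r) none

  upper : ∀ {s} → 3 ≤ s → s * h k < n → RainbowTriangle c ⊎ MonoPtPlus (suc s) c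
  upper {s} 3≤s big with rainbow? | lolly-of-length? (suc s)
  ... | yes r | _ = inj₁ r
  ... | no _ | yes (a , xs , len , u , r) = inj₂ (subst (λ t → MonoPtPlus t c) len (lolly⇒mono u r))
  ... | no none | no short = contradiction bound (<⇒≱ big)
    where
    open Bound (noRainbow none) s 3≤s

    V = allFin n
    K = map (_, 0) (allFin (suc k))

    palette≡ : palette K ≡ allFin (suc k)
    palette≡ = trans (sym (map-∘ (allFin (suc k)))) (map-id (allFin (suc k)))

    limits : ∀ {e} → Lim s e 0 V
    limits {e} {m} r with suc s ≤? m
    ... | no ¬le = ≤-trans (≤-reflexive (+-identityʳ m)) (s≤s⁻¹ (≰⇒> ¬le))
    ... | yes le with shorten (m ∸ suc s) (≤-trans 3≤s (n≤1+n s)) (subst (RopeIn lolly e V) (sym (m∸n+n≡m le)) r)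
    ...   | rope len u _ r′ = contradiction (e , _ , len , u , r′) short

    valid-K : Valid V K
    valid-K = valid (λ {x} {y} _ _ _ → subst (col c x y ∈_) (sym palette≡) (∈-allFin _)) lims
      where
      lims : ∀ {e d} → (e , d) ∈ K → Lim s e d V
      lims p with ∈-map⁻ (_, 0) p
      ... | _ , _ , refl = limits

    length-K : length (map (_, 0) (tabulate {n = k} suc)) ≡ k
    length-K = trans (length-map (_, 0) (tabulate {n = k} suc)) (length-tabulate {n = k} suc)

    bound : n ≤ s * h k
    bound = ≤-trans (≤-reflexive (sym (length-tabulate {n = n} id))) (≤-trans (m≤m+n _ (deficit K))
      (≤-trans (bounded (suc (length V)) V ≤-refl (Uniq.allFin⁺ n) (fromℕ< (≤-trans (s≤s z≤n) big) , ∈-allFin _)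
          _ _ (subst Unique (sym palette≡) (Uniq.allFin⁺ (suc k))) valid-K)
        (≤-reflexive (cong (λ l → s * h l) length-K))))

-- The colourings for the lower bound

-- Colour 0 marks coincident vertices, so a scheme with δ into Fin (suc k) uses k colours on edges.
record Scheme (k : ℕ) (D : Set) : Set where
  field
    δ          : D → D → Fin (suc k)
    δ-sym      : ∀ x y → δ x y ≡ δ y x
    δ-refl     : ∀ x → δ x x ≡ zero
    δ-zero     : ∀ x y → δ x y ≡ zero → x ≡ y
    no-rainbow : ∀ x y z → δ x y ≡ δ y z ⊎ δ y z ≡ δ x z ⊎ δ x y ≡ δ x z
    no-mono    : ∀ x y z → δ x y ≡ δ y z → δ y z ≡ δ x z → δ x y ≡ zero

point : Scheme 0 (Fin 1)
point = record
  { δ = λ _ _ → zero ; δ-sym = λ _ _ → refl ; δ-refl = λ _ → refl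
  ; δ-zero = λ { zero zero _ → refl } ; no-rainbow = λ _ _ _ → inj₁ refl ; no-mono = λ _ _ _ _ _ → refl }

module _ {k n : ℕ} (δ : Fin n → Fin n → Fin (suc k)) where

  Laws : Set
  Laws = (∀ x y → δ x y ≡ δ y x) × (∀ x → δ x x ≡ zero) × (∀ x y → δ x y ≡ zero → x ≡ y) ×
    (∀ x y z → δ x y ≡ δ y z ⊎ δ y z ≡ δ x z ⊎ δ x y ≡ δ x z) ×
    (∀ x y z → δ x y ≡ δ y z → δ y z ≡ δ x z → δ x y ≡ zero)

  -- For a concrete `δ` this evaluates, so the laws of `edge` and `pentagon` hold by computation.
  laws? : Dec Laws
  laws? = Fin.all? (λ x → Fin.all? λ y → δ x y Fin.≟ δ y x) ×-dec
    Fin.all? (λ x → δ x x Fin.≟ zero) ×-dec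
    Fin.all? (λ x → Fin.all? λ y → (δ x y Fin.≟ zero) →-dec (x Fin.≟ y)) ×-dec
    Fin.all? (λ x → Fin.all? λ y → Fin.all? λ z →
      (δ x y Fin.≟ δ y z) ⊎-dec (δ y z Fin.≟ δ x z) ⊎-dec (δ x y Fin.≟ δ x z)) ×-dec
    Fin.all? (λ x → Fin.all? λ y → Fin.all? λ z →
      (δ x y Fin.≟ δ y z) →-dec ((δ y z Fin.≟ δ x z) →-dec (δ x y Fin.≟ zero)))

  scheme : Laws → Scheme k (Fin n)
  scheme (p , q , r , s , t) = record { δ = δ ; δ-sym = p ; δ-refl = q ; δ-zero = r ; no-rainbow = s ; no-mono = t }

edge-δ : Fin 2 → Fin 2 → Fin 2
edge-δ zero    zero    = zero
edge-δ (suc _) (suc _) = zero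
edge-δ _       _       = suc zero

edge : Scheme 1 (Fin 2)
edge = scheme edge-δ (from-yes (laws? edge-δ))

-- Colour `p` is a 5-cycle and `q` its complement, again a 5-cycle; neither contains a triangle.
pentagon-δ : Fin 5 → Fin 5 → Fin 3
pentagon-δ i j = Vec.lookup (Vec.lookup table i) j
  where
  o = zero
  p = suc zero
  q = suc (suc zero)
  table : Vec.Vec (Vec.Vec (Fin 3) 5) 5
  table = (o Vec.∷ p Vec.∷ q Vec.∷ q Vec.∷ p Vec.∷ Vec.[]) Vec.∷
          (p Vec.∷ o Vec.∷ p Vec.∷ q Vec.∷ q Vec.∷ Vec.[]) Vec.∷
          (q Vec.∷ p Vec.∷ o Vec.∷ p Vec.∷ q Vec.∷ Vec.[]) Vec.∷
          (q Vec.∷ q Vec.∷ p Vec.∷ o Vec.∷ p Vec.∷ Vec.[]) Vec.∷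
          (p Vec.∷ q Vec.∷ q Vec.∷ p Vec.∷ o Vec.∷ Vec.[]) Vec.∷ Vec.[]

pentagon : Scheme 2 (Fin 5)
pentagon = scheme pentagon-δ (from-yes (laws? pentagon-δ))

module Substitute {k : ℕ} {D : Set} (inner : Scheme k D) where

  open Scheme inner
  module P = Scheme pentagon

  -- A nonzero outer colour overrides the inner one; inside one copy the inner colours are shifted
  -- past the two of the pentagon.
  join : Fin 3 → Fin (suc k) → Fin (3 + k)
  join zero                zero    = zero
  join zero                (suc c) = suc (suc (suc c))
  join (suc zero)          _       = suc zero
  join (suc (suc zero))    _       = suc (suc zero)

  join-injective₁ : ∀ p q {u v} → join p u ≡ join q v → p ≡ q
  join-injective₁ zero zero _ = refl
  join-injective₁ zero (suc zero) {zero} ()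
  join-injective₁ zero (suc zero) {suc _} ()
  join-injective₁ zero (suc (suc zero)) {zero} ()
  join-injective₁ zero (suc (suc zero)) {suc _} ()
  join-injective₁ (suc zero) zero {v = zero} ()
  join-injective₁ (suc zero) zero {v = suc _} ()
  join-injective₁ (suc zero) (suc zero) _ = refl
  join-injective₁ (suc zero) (suc (suc zero)) ()
  join-injective₁ (suc (suc zero)) zero {v = zero} ()
  join-injective₁ (suc (suc zero)) zero {v = suc _} ()
  join-injective₁ (suc (suc zero)) (suc zero) ()
  join-injective₁ (suc (suc zero)) (suc (suc zero)) _ = refl

  join-injective₂ : ∀ u v → join zero u ≡ join zero v → u ≡ v
  join-injective₂ zero zero _ = refl
  join-injective₂ (suc u) (suc v) refl = refl

  join-suc : ∀ c {u v} → join (suc c) u ≡ join (suc c) v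
  join-suc zero = refl
  join-suc (suc zero) = refl

  δ′ : Fin 5 × D → Fin 5 × D → Fin (3 + k)
  δ′ (x , u) (y , v) = join (P.δ x y) (δ u v)

  -- Equal outer colours are either both 0, so that each pair stays inside one copy, or override
  -- whatever the inner colours are.
  same-or-equal : ∀ {x y z w} → P.δ x y ≡ P.δ z w → x ≡ y × z ≡ w ⊎ (∀ {u v} → join (P.δ x y) u ≡ join (P.δ z w) v)
  same-or-equal {x} {y} {z} {w} e with P.δ x y in eq | P.δ z w in eq′
  same-or-equal refl | zero | _ = inj₁ (P.δ-zero _ _ eq , P.δ-zero _ _ eq′)
  same-or-equal refl | suc c | _ = inj₂ (join-suc c)

  inner-rainbow : ∀ x u v w → let c = P.δ x x in
    join c (δ u v) ≡ join c (δ v w) ⊎ join c (δ v w) ≡ join c (δ u w) ⊎ join c (δ u v) ≡ join c (δ u w)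
  inner-rainbow x u v w with no-rainbow u v w
  ... | inj₁ e = inj₁ (cong (join _) e)
  ... | inj₂ (inj₁ e) = inj₂ (inj₁ (cong (join _) e))
  ... | inj₂ (inj₂ e) = inj₂ (inj₂ (cong (join _) e))

  substituted : Scheme (2 + k) (Fin 5 × D)
  substituted = record
    { δ = δ′
    ; δ-sym = λ { (x , u) (y , v) → cong₂ join (P.δ-sym x y) (δ-sym u v) }
    ; δ-refl = λ { (x , u) → cong₂ join (P.δ-refl x) (δ-refl u) }
    ; δ-zero = λ { (x , u) (y , v) e → δ-zero′ x u y v e }
    ; no-rainbow = λ { (x , u) (y , v) (z , w) → rainbow x u y v z w }
    ; no-mono = λ { (x , u) (y , v) (z , w) e e′ → mono x u y v z w e e′ } }
    where
    δ-zero′ : ∀ x u y v → join (P.δ x y) (δ u v) ≡ zero → (x , u) ≡ (y , v)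
    δ-zero′ x u y v e with join-injective₁ (P.δ x y) zero {δ u v} {zero} e
    ... | p = cong₂ _,_ (P.δ-zero x y p)
                (δ-zero u v (join-injective₂ (δ u v) zero (trans (cong (λ c → join c (δ u v)) (sym p)) e)))

    rainbow : ∀ x u y v z w → let a = δ′ (x , u) (y , v) ; b = δ′ (y , v) (z , w) ; c = δ′ (x , u) (z , w) in
              a ≡ b ⊎ b ≡ c ⊎ a ≡ c
    rainbow x u y v z w with P.no-rainbow x y z
    rainbow x u y v z w | inj₁ e with same-or-equal {x} {y} {y} {z} e
    ... | inj₁ (refl , refl) = inner-rainbow x u v w
    ... | inj₂ same = inj₁ same
    rainbow x u y v z w | inj₂ (inj₁ e) with same-or-equal {y} {z} {x} {z} e
    ... | inj₁ (refl , refl) = inner-rainbow x u v w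
    ... | inj₂ same = inj₂ (inj₁ same)
    rainbow x u y v z w | inj₂ (inj₂ e) with same-or-equal {x} {y} {x} {z} e
    ... | inj₁ (refl , refl) = inner-rainbow x u v w
    ... | inj₂ same = inj₂ (inj₂ same)

    mono : ∀ x u y v z w → δ′ (x , u) (y , v) ≡ δ′ (y , v) (z , w) → δ′ (y , v) (z , w) ≡ δ′ (x , u) (z , w) →
           δ′ (x , u) (y , v) ≡ zero
    mono x u y v z w e e′ = trans (cong (λ c → join c (δ u v)) xy)
        (cong (join zero) (no-mono u v w (join-injective₂ _ _
            (trans (cong (λ c → join c (δ u v)) (sym xy)) (trans e (cong (λ c → join c (δ v w)) yz))))
          (join-injective₂ _ _ (trans (cong (λ c → join c (δ v w)) (sym yz)) (trans e′ (cong (λ c → join c (δ u w)) xz))))))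
      where
      p = join-injective₁ (P.δ x y) (P.δ y z) e
      q = join-injective₁ (P.δ y z) (P.δ x z) e′
      xy = P.no-mono x y z p q
      yz = trans (sym p) xy
      xz = trans (sym q) yz

Vertex : ℕ → Set
Vertex 0 = Fin 1
Vertex 1 = Fin 2
Vertex (suc (suc k)) = Fin 5 × Vertex k

vertex-scheme : ∀ k → Scheme k (Vertex k)
vertex-scheme 0 = point
vertex-scheme 1 = edge
vertex-scheme (suc (suc k)) = Substitute.substituted (vertex-scheme k)

remQuot-injective : ∀ {m} n {i j : Fin (m * n)} → remQuot {m} n i ≡ remQuot n j → i ≡ j
remQuot-injective {m} n {i} {j} e =
  trans (sym (combine-remQuot {m} n i)) (trans (cong (uncurry combine) e) (combine-remQuot {m} n j))

vertex : ∀ k → Fin (h k) → Vertex k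
vertex 0 i = i
vertex 1 i = i
vertex (suc (suc k)) i = proj₁ (remQuot {5} (h k) i) , vertex k (proj₂ (remQuot {5} (h k) i))

vertex-injective : ∀ k {i j} → vertex k i ≡ vertex k j → i ≡ j
vertex-injective 0 e = e
vertex-injective 1 e = e
vertex-injective (suc (suc k)) e = remQuot-injective {5} (h k) (cong₂ _,_ (cong proj₁ e) (vertex-injective k (cong proj₂ e)))

module Lower (s₀ k m : ℕ) (m≤ : m ≤ (3 + s₀) * h k) where

  s = 3 + s₀

  open Scheme (vertex-scheme k)

  -- The second coordinate names the copy of K_s and the first a position in it. Embedding `Fin m`
  -- treats all smaller orders at once.
  place : Fin m → Fin s × Fin (h k)
  place x = remQuot {s} (h k) (inject≤ x m≤)

  place-injective : ∀ {x y} → place x ≡ place y → x ≡ y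
  place-injective e = inject≤-injective m≤ m≤ _ _ (remQuot-injective {s} (h k) e)

  copy : Fin m → Vertex k
  copy = vertex k ∘ proj₂ ∘ place

  colouring : EdgeColoring m (suc k)
  colouring = record { col = λ x y → δ (copy x) (copy y) ; symm = λ x y → δ-sym (copy x) (copy y) }

  not-rainbow : ¬ RainbowTriangle colouring
  not-rainbow (x , y , z , _ , _ , _ , p , q , r) = [ p , [ q , r ]′ ]′ (no-rainbow (copy x) (copy y) (copy z))

  -- The triangle forces colour 0, whose edges stay inside one copy of K_s.
  not-mono : ¬ MonoPtPlus (suc s) colouring
  not-mono (f , a , f-injective , edges , chord) = <⇒≢ (proj₁ (proj₂ (proj₂ collision))) (cong toℕ (f-injective (place-injective
          (cong₂ _,_ (proj₂ (proj₂ (proj₂ collision)))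
            (vertex-injective k (trans (constant _ (proj₁ collision) refl) (sym (constant _ (proj₁ (proj₂ collision)) refl))))))))
    where
    a≡0 : a ≡ zero
    a≡0 = trans (sym (edges zero (suc zero) refl)) (no-mono _ _ _
      (trans (edges zero (suc zero) refl) (sym (edges (suc zero) (suc (suc zero)) refl)))
      (trans (edges (suc zero) (suc (suc zero)) refl) (sym (chord zero (suc (suc zero)) refl refl))))

    constant : ∀ n (i : Fin (suc s)) → toℕ i ≡ n → copy (f i) ≡ copy (f zero)
    constant zero zero _ = refl
    constant (suc n) (suc i) e = trans
      (sym (δ-zero _ _ (trans (edges (inject₁ i) (suc i) (cong suc (toℕ-inject₁ i))) a≡0)))
      (constant n (inject₁ i) (trans (toℕ-inject₁ i) (suc-injective e)))

    -- All `s + 1` vertices lie in one copy, which has only `s` positions.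
    collision = pigeonhole ≤-refl (proj₁ ∘ place ∘ f)

-- The Gallai-Ramsey numbers and their closed form

-- Of the `suc k` colours of the extremal colouring, `k` belong to the scheme on `h k` vertices and
-- colour 0 fills the copies of K_s, which matches the `h k` of the upper bound.
gallai-ramsey : ∀ s k → 3 ≤ s → IsGRNumber (suc k) (suc s) (s * h k + 1)
gallai-ramsey s@(suc (suc (suc s₀))) k 3≤s@(s≤s (s≤s (s≤s _))) =
  (λ c → Upper.upper c 3≤s (≤-reflexive (+-comm 1 (s * h k)))) , λ m m< property →
  let open Lower s₀ k m (s≤s⁻¹ (≤-trans m< (≤-reflexive (+-comm (s * h k) 1))))
  in [ not-rainbow , not-mono ]′ (property colouring)

h-even : ∀ j → h (2 * j) ≡ 5 ^ j
h-even zero = refl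
h-even (suc j) = trans (cong h (cong suc (+-suc j (j + 0)))) (cong (5 *_) (h-even j))

h-odd : ∀ j → h (2 * j + 1) ≡ 2 * 5 ^ j
h-odd zero = refl
h-odd (suc j) = trans (cong (λ i → h (suc i + 1)) (+-suc j (j + 0)))
  (trans (cong (5 *_) (h-odd j)) (five-comm 2 (5 ^ j)))

theorem12 : ∀ (t : ℕ) → 4 ≤ t →
    (∀ (j : ℕ) → IsGRNumber (2 * j + 2) t (2 * (t ∸ 1) * 5 ^ j + 1)) ×
    (∀ (j : ℕ) → IsGRNumber (2 * j + 1) t ((t ∸ 1) * 5 ^ j + 1))
theorem12 (suc s) (s≤s 3≤s) =
    (λ j → subst₂ (λ k n → IsGRNumber k (suc s) (n + 1)) (sym (+-suc (2 * j) 1))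
      (trans (cong (s *_) (h-odd j)) (trans (sym (*-assoc s 2 (5 ^ j))) (cong (_* 5 ^ j) (*-comm s 2))))
      (gallai-ramsey s (2 * j + 1) 3≤s))
  , (λ j → subst₂ (λ k n → IsGRNumber k (suc s) (n + 1)) (+-comm 1 (2 * j)) (cong (s *_) (h-even j))
      (gallai-ramsey s (2 * j) 3≤s))
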